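{- There exists a constant $\alpha>0$ such that the following holds. For even $n$, let $M_1,M_2,M_3$ be independent uniformly chosen random perfect matchings on a common set of $n$ vertices (i.e. of the complete graph $K_n$), and let $G=M_1\cup M_2\cup M_3$. Then with high probability $\alpha n$ cops do not suffice to catch the robber on $G$; that is, $\Pr[\mathrm{ent}(G)>\alpha n]\to 1$ as $n\to\infty$ through even integers.
   Context: Entanglement game on a finite graph $G$ with $k$ cops: First the robber chooses a starting vertex, and all $k$ cops are outside the graph. In every turn, the cops either all stay where they are, or exactly one of them flies (from wherever it is, on or off the graph) to the current position of the robber. Regardless of which of these happened, the robber then has to move to a neighbor of his current position that is not occupied by a cop. If there is no such neighbor, the cops win. The robber wins if he can run away indefinitely. Both sides have full information. The entanglement number $\mathrm{ent}(G)$ is the minimal integer $k$ such that $k$ cops have a strategy to catch the robber on $G$. "$\alpha n$ cops do not suffice" means that no integer number $k\le\alpha n$ of cops can catch the robber, i.e. $\mathrm{ent}(G)>\alpha n$. The union of matchings is the graph on the $n$ vertices whose edge set is the union of the three edge sets. "With high probability" means with probability tending to $1$ as $n\to\infty$. -}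

module Defs where

open import Data.Bool.Base using (true; false)
open import Data.Empty using (⊥)
open import Data.Fin.Base using (Fin)
import Data.Fin.Properties as Fin
open import Data.Fin.Subset using (Subset; inside; outside; _∈_; _∪_; ∣_∣)
open import Data.Fin.Subset.Properties using (_∈?_; x∈p∪q⁺; x∈p∪q⁻)
open import Data.Integer.Base using (+_)
open import Data.List.Base
  using (List; []; _∷_; length; filter; allFin; map; cartesianProduct; cartesianProductWith)
open import Data.List.Membership.Propositional using () renaming (_∈_ to _∈ₗ_)
open import Data.List.Membership.Propositional.Properties
  using (∈-filter⁺; ∈-filter⁻; ∈-cartesianProduct⁺; ∈-cartesianProductWith⁺; ∈-allFin; ∈-map⁺)
open import Data.List.Relation.Unary.All using ([]; _∷_)
open import Data.List.Relation.Unary.AllPairs using ([]; _∷_)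
open import Data.List.Relation.Unary.Any using (here; there)
open import Data.List.Relation.Unary.Unique.Propositional using (Unique)
import Data.List.Relation.Unary.Unique.Propositional.Properties as Unique
open import Data.List.Properties using (length-filter)
open import Data.Maybe.Base using (Maybe; just; nothing)
open import Data.Maybe.Properties using (≡-dec)
open import Data.Nat.Base using (ℕ; zero; suc; _+_; z≤n; s≤s) renaming (_≤_ to _≤ⁿ_; _<_ to _<ⁿ_)
import Data.Nat.Properties as ℕ
open import Data.Product.Base using (∃; _×_; _,_; proj₁; proj₂)
open import Data.Rational.Base using (ℚ; 0ℚ; _/_; _<_; _-_) renaming (∣_∣ to ∣_∣ℚ)
open import Data.Sum.Base using (_⊎_; inj₁; inj₂)
import Data.Sum.Base as Sum
open import Data.Vec.Base using (Vec; []; _∷_; lookup; replicate; zipWith; _[_]≔_)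
import Data.Vec.Membership.DecPropositional as DecMembership
open import Data.Vec.Membership.Propositional using () renaming (_∈_ to _∈ᵥ_)
open import Data.Vec.Membership.Propositional.Properties using (∈-lookup)
open import Data.Vec.Properties
  using (lookup-replicate; lookup∘update; lookup∘update′; lookup-zipWith; ∷-injective)
open import Data.Vec.Relation.Unary.Any using (here; there)
open import Function.Base using (_∘_)
open import Level using (Level)
open import Relation.Binary.PropositionalEquality
  using (_≡_; refl; sym; subst)
open import Relation.Nullary using (Dec; yes; no; ¬_; contradiction; ¬?)
open import Relation.Nullary.Decidable using (map′; _×-dec_; _→-dec_; _⊎-dec_)
open import Relation.Unary using (Pred; Decidable)

private
  variable
    a p : Level
    A   : Set a
    n k : ℕ

-- A graph on the vertex set Fin n is the vector of the neighbourhoods of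
-- its vertices.

Graph : ℕ → Set
Graph n = Vec (Subset n) n

Adj : Graph n → Fin n → Fin n → Set
Adj G x y = y ∈ lookup G x

adj? : (G : Graph n) (x y : Fin n) → Dec (Adj G x y)
adj? G x y = y ∈? lookup G x

IsSimple : Graph n → Set
IsSimple G = (∀ x y → Adj G x y → Adj G y x) × (∀ x → ¬ Adj G x x)

isSimple? : Decidable (IsSimple {n})
isSimple? G =
  Fin.all? (λ x → Fin.all? λ y → adj? G x y →-dec adj? G y x)
  ×-dec Fin.all? (λ x → ¬? (adj? G x x))

-- A set of edges of the complete graph covering every vertex exactly once.

IsPerfectMatching : Graph n → Set
IsPerfectMatching M = IsSimple M × (∀ x → ∣ lookup M x ∣ ≡ 1)

isPerfectMatching? : Decidable (IsPerfectMatching {n})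
isPerfectMatching? M = isSimple? M ×-dec Fin.all? (λ x → ∣ lookup M x ∣ ℕ.≟ 1)

infixl 6 _∪ᴳ_
_∪ᴳ_ : Graph n → Graph n → Graph n
_∪ᴳ_ = zipWith _∪_

Adj-∪ᴳ⁻ : (G H : Graph n) (x y : Fin n) →
          Adj (G ∪ᴳ H) x y → Adj G x y ⊎ Adj H x y
Adj-∪ᴳ⁻ G H x y e =
  x∈p∪q⁻ (lookup G x) (lookup H x) (subst (y ∈_) (lookup-zipWith _∪_ x G H) e)

Adj-∪ᴳ⁺ : (G H : Graph n) (x y : Fin n) →
          Adj G x y ⊎ Adj H x y → Adj (G ∪ᴳ H) x y
Adj-∪ᴳ⁺ G H x y e =
  subst (y ∈_) (sym (lookup-zipWith _∪_ x G H)) (x∈p∪q⁺ e)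

∪ᴳ-isSimple : (G H : Graph n) → IsSimple G → IsSimple H → IsSimple (G ∪ᴳ H)
∪ᴳ-isSimple G H (symG , irrG) (symH , irrH) =
  (λ x y e → Adj-∪ᴳ⁺ G H y x (Sum.map (symG x y) (symH x y) (Adj-∪ᴳ⁻ G H x y e))) ,
  (λ x e → Sum.[ irrG x , irrH x ] (Adj-∪ᴳ⁻ G H x x e))

-- Positions of the k cops; nothing means outside the graph.

Cops : ℕ → ℕ → Set
Cops n k = Vec (Maybe (Fin n)) k

Occupied : Cops n k → Fin n → Set
Occupied c v = just v ∈ᵥ c

occupied? : (c : Cops n k) → Decidable (Occupied c)
occupied? c v = just v ∈ᵥ? c
  where open DecMembership (≡-dec Fin._≟_) renaming (_∈?_ to _∈ᵥ?_)

data CopMove (r : Fin n) (c : Cops n k) : Cops n k → Set where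
  stay : CopMove r c c
  fly  : ∀ i → CopMove r c (c [ i ]≔ just r)

-- The cops, to move with the robber at r, can catch the robber.  An element
-- is a cop strategy: a cop move together with a continuation for every legal
-- answer of the robber.  Being inductive, it rules out infinite plays; a
-- robber without a legal answer is caught.

data CopsWin (G : Graph n) (c : Cops n k) (r : Fin n) : Set where
  turn : ∀ {c′} → CopMove r c c′ →
         (∀ r′ → Adj G r r′ → ¬ Occupied c′ r′ → CopsWin G c′ r′) →
         CopsWin G c r

CanCatch : ℕ → Graph n → Set
CanCatch {n} k G = ∀ (r : Fin n) → CopsWin G (replicate k nothing) r

vectors : List A → ∀ n → List (Vec A n)
vectors xs zero    = [] ∷ []
vectors xs (suc n) = cartesianProductWith _∷_ xs (vectors xs n)

∈-vectors : {xs : List A} → (∀ x → x ∈ₗ xs) → ∀ {n} (v : Vec A n) → v ∈ₗ vectors xs n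
∈-vectors ∈xs []      = here refl
∈-vectors ∈xs (x ∷ v) = ∈-cartesianProductWith⁺ _∷_ (∈xs x) (∈-vectors ∈xs v)

vectors-unique : {xs : List A} → Unique xs → ∀ n → Unique (vectors xs n)
vectors-unique xs! zero    = [] ∷ []
vectors-unique xs! (suc n) =
  Unique.cartesianProductWith⁺ _∷_ ∷-injective xs! (vectors-unique xs! n)

subsets : ∀ n → List (Subset n)
subsets = vectors (outside ∷ inside ∷ [])

∈-subsets : (s : Subset n) → s ∈ₗ subsets n
∈-subsets = ∈-vectors λ where
  false → here refl
  true  → there (here refl)

subsets-unique : ∀ n → Unique (subsets n)
subsets-unique = vectors-unique (((λ ()) ∷ []) ∷ [] ∷ [])

perfectMatchings : ∀ n → List (Graph n)
perfectMatchings n = filter isPerfectMatching? (vectors (subsets n) n)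

∈-perfectMatchings⁺ : {M : Graph n} → IsPerfectMatching M → M ∈ₗ perfectMatchings n
∈-perfectMatchings⁺ {M = M} pm =
  ∈-filter⁺ isPerfectMatching? (∈-vectors ∈-subsets M) pm

∈-perfectMatchings⁻ : {M : Graph n} → M ∈ₗ perfectMatchings n → IsPerfectMatching M
∈-perfectMatchings⁻ {n} M∈ =
  proj₂ (∈-filter⁻ isPerfectMatching? {xs = vectors (subsets n) n} M∈)

perfectMatchings-unique : ∀ n → Unique (perfectMatchings n)
perfectMatchings-unique n =
  Unique.filter⁺ isPerfectMatching? (vectors-unique (subsets-unique n) n)

-- Drawing uniformly from this product is drawing three independent uniform
-- perfect matchings.

matchingTriples : ∀ n → List (Graph n × Graph n × Graph n)
matchingTriples n =
  cartesianProduct (perfectMatchings n)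
    (cartesianProduct (perfectMatchings n) (perfectMatchings n))

unionOf : Graph n × Graph n × Graph n → Graph n
unionOf (M₁ , M₂ , M₃) = M₁ ∪ᴳ M₂ ∪ᴳ M₃

private
  module _ {P : Pred A p} (P? : Decidable P) where

    #_ : List A → ℕ
    # xs = length (filter P? xs)

  #-mono : {P Q : Pred A p} (P? : Decidable P) (Q? : Decidable Q) →
           (∀ {x} → P x → Q x) → ∀ xs → #_ P? xs ≤ⁿ #_ Q? xs
  #-mono P? Q? P⊆Q []       = z≤n
  #-mono P? Q? P⊆Q (x ∷ xs) with P? x | Q? x
  ... | yes _  | yes _  = s≤s (#-mono P? Q? P⊆Q xs)
  ... | yes px | no ¬qx = contradiction (P⊆Q px) ¬qx
  ... | no _   | yes _  = ℕ.m≤n⇒m≤1+n (#-mono P? Q? P⊆Q xs)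
  ... | no _   | no _   = #-mono P? Q? P⊆Q xs

  #-strict : {P Q : Pred A p} (P? : Decidable P) (Q? : Decidable Q) →
             (∀ {x} → P x → Q x) → ∀ xs → #_ Q? xs ≤ⁿ #_ P? xs →
             ∀ {x} → x ∈ₗ xs → Q x → P x
  #-strict P? Q? P⊆Q (x ∷ xs) le x∈ qx with P? x | Q? x
  #-strict P? Q? P⊆Q (x ∷ xs) le (here refl) qx | yes px | _      = px
  #-strict P? Q? P⊆Q (x ∷ xs) le (here refl) qx | no _   | no ¬qx = contradiction qx ¬qx
  #-strict P? Q? P⊆Q (x ∷ xs) le (there x∈)  qx | yes _  | yes _  =
    #-strict P? Q? P⊆Q xs (ℕ.≤-pred le) x∈ qx
  #-strict P? Q? P⊆Q (x ∷ xs) le (there x∈)  qx | yes px | no ¬qx = contradiction (P⊆Q px) ¬qx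
  #-strict P? Q? P⊆Q (x ∷ xs) le x∈          qx | no _   | yes _  =
    contradiction (ℕ.≤-trans le (#-mono P? Q? P⊆Q xs)) ℕ.1+n≰n
  #-strict P? Q? P⊆Q (x ∷ xs) le (there x∈)  qx | no _   | no _   =
    #-strict P? Q? P⊆Q xs le x∈ qx

  plateau : (f : ℕ → ℕ) (b : ℕ) → (∀ t → f t ≤ⁿ b) → ∃ λ t → f (suc t) ≤ⁿ f t
  plateau f b f≤b = go b 0 (ℕ.m≤n+m b (f 0))
    where
    go : ∀ d t → b ≤ⁿ f t + d → ∃ λ t → f (suc t) ≤ⁿ f t
    go d t le with f (suc t) ℕ.≤? f t
    ... | yes q = t , q
    go zero t le | no ¬q =
      t , ℕ.≤-trans (f≤b (suc t)) (subst (b ≤ⁿ_) (ℕ.+-identityʳ (f t)) le)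
    go (suc d) t le | no ¬q = go d (suc t)
      (ℕ.≤-trans le (subst (_≤ⁿ f (suc t) + d) (sym (ℕ.+-suc (f t) d))
        (ℕ.+-monoˡ-≤ d (ℕ.≰⇒> ¬q))))

-- The game is decided by iterating "the cops win within t turns" until the set
-- of winning positions no longer grows.

private
  module Decide {n k : ℕ} (G : Graph n) where

    Position : Set
    Position = Cops n k × Fin n

    Reply : Pred Position _ → Fin n → Cops n k → Set
    Reply W r c′ = ∀ r′ → Adj G r r′ → ¬ Occupied c′ r′ → W (c′ , r′)

    Within : ℕ → Pred Position _
    Within zero    _       = ⊥
    Within (suc t) (c , r) =
      Reply (Within t) r c ⊎ ∃ λ i → Reply (Within t) r (c [ i ]≔ just r)

    within? : ∀ t → Decidable (Within t)
    within? zero    _       = no λ ()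
    within? (suc t) (c , r) = reply? c ⊎-dec Fin.any? (λ i → reply? (c [ i ]≔ just r))
      where
      reply? : ∀ c′ → Dec (Reply (Within t) r c′)
      reply? c′ = Fin.all? λ r′ →
        adj? G r r′ →-dec (¬? (occupied? c′ r′) →-dec within? t (c′ , r′))

    within-suc : ∀ t {q} → Within t q → Within (suc t) q
    within-suc (suc t) (inj₁ f)       = inj₁ λ r′ e o → within-suc t (f r′ e o)
    within-suc (suc t) (inj₂ (i , f)) = inj₂ (i , λ r′ e o → within-suc t (f r′ e o))

    sound : ∀ t {c r} → Within t (c , r) → CopsWin G c r
    sound (suc t) (inj₁ f)       = turn stay    λ r′ e o → sound t (f r′ e o)
    sound (suc t) (inj₂ (i , f)) = turn (fly i) λ r′ e o → sound t (f r′ e o)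

    positions : List Position
    positions = cartesianProduct (vectors (nothing ∷ map just (allFin n)) k) (allFin n)

    ∈-positions : ∀ q → q ∈ₗ positions
    ∈-positions (c , r) = ∈-cartesianProduct⁺ (∈-vectors ∈places c) (∈-allFin r)
      where
      ∈places : ∀ m → m ∈ₗ (nothing ∷ map just (allFin n))
      ∈places nothing  = here refl
      ∈places (just v) = there (∈-map⁺ just (∈-allFin v))

    stable : ∃ λ t → ∀ {q} → Within (suc t) q → Within t q
    stable with plateau (λ t → length (filter (within? t) positions))
                        (length positions) (λ t → length-filter (within? t) positions)
    ... | t , le = t , λ {q} →
      #-strict (within? t) (within? (suc t)) (within-suc t) positions le (∈-positions q)

    bound : ℕ
    bound = proj₁ stable

    complete : ∀ {c r} → CopsWin G c r → Within bound (c , r)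
    complete (turn stay f)    = proj₂ stable (inj₁ λ r′ e o → complete (f r′ e o))
    complete (turn (fly i) f) = proj₂ stable (inj₂ (i , λ r′ e o → complete (f r′ e o)))

copsWin? : (G : Graph n) (c : Cops n k) (r : Fin n) → Dec (CopsWin G c r)
copsWin? G c r = map′ (sound bound) complete (within? bound (c , r))
  where open Decide G

canCatch? : (G : Graph n) → Decidable (λ k → CanCatch k G)
canCatch? G k = Fin.all? λ r → copsWin? G (replicate k nothing) r

-- n cops suffice on n vertices: cop v flies to v when the robber visits v.

private
  free : Cops n k → ℕ
  free []            = 0
  free (nothing ∷ c) = suc (free c)
  free (just _ ∷ c)  = free c

  free-update : (c : Cops n k) (i : Fin k) (v : Fin n) → lookup c i ≡ nothing →
                free (c [ i ]≔ just v) <ⁿ free c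
  free-update (nothing ∷ c) Fin.zero    v eq = ℕ.≤-refl
  free-update (nothing ∷ c) (Fin.suc i) v eq = s≤s (free-update c i v eq)
  free-update (just _ ∷ c)  (Fin.suc i) v eq = free-update c i v eq

  Home : Cops n n → Set
  Home c = ∀ i → lookup c i ≡ nothing ⊎ lookup c i ≡ just i

  home-update : (c : Cops n n) (v : Fin n) → Home c → Home (c [ v ]≔ just v)
  home-update c v h i with i Fin.≟ v
  ... | yes refl = inj₂ (lookup∘update v c (just v))
  ... | no i≢v   rewrite lookup∘update′ i≢v c (just v) = h i

  hunt : (G : Graph n) (c : Cops n n) (r : Fin n) (s : ℕ) →
         free c ≤ⁿ s → Home c → ¬ Occupied c r → CopsWin G c r
  hunt G c r s le h o with h r
  ... | inj₂ eq = contradiction (subst (_∈ᵥ c) eq (∈-lookup r c)) o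
  hunt G c r zero le h o | inj₁ eq =
    contradiction (ℕ.≤-trans (free-update c r r eq) le) λ ()
  hunt G c r (suc s) le h o | inj₁ eq = turn (fly r) λ r′ _ o′ →
    hunt G (c [ r ]≔ just r) r′ s
      (ℕ.≤-pred (ℕ.≤-trans (free-update c r r eq) le)) (home-update c r h) o′

  outside-free : ∀ k {v : Fin n} → ¬ Occupied (replicate k nothing) v
  outside-free (suc k) (there o) = outside-free k o

canCatch-all : (G : Graph n) → CanCatch n G
canCatch-all {n} G r =
  hunt G (replicate n nothing) r _ ℕ.≤-refl
    (λ i → inj₁ (lookup-replicate i nothing)) (outside-free n)

private
  least : {P : ℕ → Set p} → (∀ k → Dec (P k)) → ∀ n → P n →
          ∃ λ k → P k × (∀ j → P j → k ≤ⁿ j)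
  least P? n pn with P? 0
  ... | yes p0 = 0 , p0 , λ _ _ → z≤n
  least P? zero    pn | no ¬p0 = contradiction pn ¬p0
  least {P = P} P? (suc n) pn | no ¬p0 with least {P = P ∘ suc} (P? ∘ suc) n pn
  ... | k , pk , min = suc k , pk , λ where
    zero    p0 → contradiction p0 ¬p0
    (suc j) pj → s≤s (min j pj)

ent-least : (G : Graph n) → ∃ λ k → CanCatch k G × (∀ j → CanCatch j G → k ≤ⁿ j)
ent-least {n} G = least (canCatch? G) n (canCatch-all G)

ent : Graph n → ℕ
ent G = proj₁ (ent-least G)

ent-canCatch : (G : Graph n) → CanCatch (ent G) G
ent-canCatch G = proj₁ (proj₂ (ent-least G))

ent-minimal : (G : Graph n) → ∀ j → CanCatch j G → ent G ≤ⁿ j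
ent-minimal G = proj₂ (proj₂ (ent-least G))

fromℕ : ℕ → ℚ
fromℕ m = + m / 1

-- The probability that a uniformly random entry of xs satisfies P (0 by
-- convention if xs is empty).

Pr : {P : Pred A p} → List A → Decidable P → ℚ
Pr {A = A} xs P? with length xs
... | zero  = 0ℚ
... | suc m = + length (filter P? xs) / suc m

infix 4 _⟶_
_⟶_ : (ℕ → ℚ) → ℚ → Set
f ⟶ l = ∀ ε → 0ℚ < ε → ∃ λ N → ∀ m → N ≤ⁿ m → ∣ f m - l ∣ℚ < ε

module Submission where

-- Colour the vertices by a separator with at most n/102 vertices and two sides without
-- edges between them, one side having between n/3 and 2n/3 vertices.
--
-- If the graph has no such colouring, then, relative to any position of the cops, a vertex
-- set that can only be left through cops has fewer than n/3 or at least 2n/3 vertices, so the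
-- small sets of this kind are closed under union.  The robber stays outside the union of the
-- small ones and is never caught.
--
-- For a fixed colouring and one random matching, revealing the partners of the separator
-- vertices first leaves two sides of about n/3 or more vertices to be matched separately,
-- which has probability at most about 5⁻ⁿᐟ⁶.  The three matchings together give 125⁻ⁿᐟ⁶,
-- which beats the number of colourings, not much more than 2ⁿ = 64ⁿᐟ⁶.

open import Defs
open import Data.Nat.Base using () renaming (_*_ to _*ⁿ_)
open import Data.Product.Base using (Σ-syntax; _×_)
open import Data.Rational using (ℚ; 0ℚ; 1ℚ; _*_; _<_; _<?_)
open import Algebra.Properties.CommutativeSemigroup using (x∙yz≈y∙xz)
open import Data.Bool.Base using (true; false)
import Data.Bool.Properties as Bool
open import Data.Fin.Base using (Fin; zero; suc; toℕ)
import Data.Fin.Properties as Fin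
open import Data.Fin.Subset using (Subset; ⁅_⁆; ∣_∣; _∈_; ⊥; ⊤; _∪_)
import Data.Fin.Subset.Properties as Subset
import Data.Integer.Base as ℤ
import Data.Integer.Properties as ℤ
open import Data.List.Base
  using (List; []; _∷_; _++_; length; filter; allFin; map; tabulate; cartesianProduct)
open import Data.List.Membership.Propositional using (find; lose) renaming (_∈_ to _∈ₗ_)
open import Data.List.Membership.Propositional.Properties
  using (∈-allFin; ∈-filter⁺; ∈-filter⁻; ∈-map⁻; ∈-++⁻; ∈-∃++)
open import Data.List.Properties
  using (filter-accept; filter-reject; filter-++; length-++; length-map; length-tabulate)
open import Data.List.Relation.Binary.Permutation.Propositional
  using (_↭_; ↭-sym; ↭-trans; prep; ↭⇒↭ₛ)
open import Data.List.Relation.Binary.Permutation.Propositional.Properties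
  using (∈-resp-↭; ↭-length; filter-↭; shift)
import Data.List.Relation.Binary.Permutation.Setoid.Properties as Permutation
open import Data.List.Relation.Unary.All using ([]; _∷_)
import Data.List.Relation.Unary.All as All
open import Data.List.Relation.Unary.AllPairs using ([]; _∷_)
open import Data.List.Relation.Unary.Any using (Any; here; there; any?)
open import Data.List.Relation.Unary.Unique.Propositional using (Unique)
import Data.List.Relation.Unary.Unique.Propositional.Properties as Unique
open import Data.Maybe.Base using (just; nothing)
import Data.Maybe.Properties as Maybe
open import Data.Nat.Base
  using (ℕ; zero; suc; pred; _+_; _^_; _≤_; z≤n; s≤s; s≤s⁻¹; NonZero; >-nonZero)
  renaming (_<_ to _<ⁿ_)
open import Data.Nat.DivMod using (_divMod_; result)
import Data.Nat.Properties as ℕ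
open import Data.Nat.Solver using (module +-*-Solver)
open import Data.Product.Base using (∃; _,_; proj₁; proj₂)
open import Data.Rational using (_/_; mkℚ; ↧ₙ_; _-_; toℚᵘ; *<*) renaming (∣_∣ to ∣_∣ℚ)
import Data.Rational.Properties as ℚ
open import Data.Rational.Unnormalised.Base using (mkℚᵘ; *<*)
import Data.Rational.Unnormalised.Base as ℚᵘ
import Data.Rational.Unnormalised.Properties as ℚᵘ
open import Data.Sum.Base using (_⊎_; inj₁; inj₂)
open import Data.Vec.Base
  using (Vec; []; _∷_; here; there; lookup; replicate; _[_]≔_; count; toList)
  renaming (tabulate to tabulateᵥ)
open import Data.Vec.Membership.Propositional using () renaming (_∈_ to _∈ᵥ_)
import Data.Vec.Membership.Propositional.Properties as ∈ᵥ
import Data.Vec.Properties as Vec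
import Data.Vec.Relation.Unary.Any as Vec
open import Function.Base using (_∘_)
open import Level using (Level)
open import Relation.Binary.PropositionalEquality
  using (_≡_; _≢_; refl; sym; trans; cong; cong₂; subst; subst₂; setoid; module ≡-Reasoning)
open import Relation.Nullary using (Dec; yes; no; ¬_; contradiction; ¬?; does)
open import Relation.Nullary.Decidable
  using (_→-dec_; _⊎-dec_; _×-dec_; dec-true; decidable-stable)
open import Relation.Unary using (Pred; Decidable)

-- The bound of a third fits because the gap is used twice: for the union of two small sets, and for
-- a small set enlarged by the robber's vertex. Both have fewer than 2n/3 vertices, so neither can
-- land beyond the gap.
--
-- The number of matchings is decided by a comparison per vertex: one matching earns 5^(1/6), about
-- 1.31, against 2 for the choice of a side. Two matchings reach only about 1.71, three about 2.24.
-- What lies between 2 and 2.24 must pay for the choice of the separator, for the vertices lost to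
-- it, and for a factor 2^t of decay, where t = ⌊n/102⌋. Since 102 = 6 * 17, there are 17t groups of
-- six vertices; t of them are given up for the separator and 16t earn a factor 5.
--
-- Until the very end there is no probability and no division: every estimate is an inequality
-- `count * factor ≤ total` between natural numbers, and such inequalities are multiplied together
-- and cancelled.

private
  variable
    ℓ₁ ℓ₂ ℓ₃ ℓ₄ : Level
    A : Set ℓ₁
    B : Set ℓ₂
    n k : ℕ

-- Counting in lists: filters, covers, pigeonhole

length-filter-mono : {P : Pred A ℓ₃} {Q : Pred A ℓ₄} (P? : Decidable P) (Q? : Decidable Q) →
                     ∀ xs → (∀ {x} → x ∈ₗ xs → P x → Q x) →
                     length (filter P? xs) ≤ length (filter Q? xs)
length-filter-mono P? Q? []       P⊆Q = z≤n
length-filter-mono P? Q? (x ∷ xs) P⊆Q with P? x | Q? x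
... | yes _  | yes _  = s≤s (length-filter-mono P? Q? xs (P⊆Q ∘ there))
... | yes px | no ¬qx = contradiction (P⊆Q (here refl) px) ¬qx
... | no _   | yes _  = ℕ.m≤n⇒m≤1+n (length-filter-mono P? Q? xs (P⊆Q ∘ there))
... | no _   | no _   = length-filter-mono P? Q? xs (P⊆Q ∘ there)

length-filter-filter : {P : Pred A ℓ₃} {Q : Pred A ℓ₄} (P? : Decidable P) (Q? : Decidable Q) →
                       ∀ xs → length (filter P? (filter Q? xs)) ≤ length (filter P? xs)
length-filter-filter P? Q? []       = z≤n
length-filter-filter P? Q? (x ∷ xs) with Q? x
length-filter-filter P? Q? (x ∷ xs) | yes _ with P? x
... | yes _ = s≤s (length-filter-filter P? Q? xs)
... | no _  = length-filter-filter P? Q? xs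
length-filter-filter P? Q? (x ∷ xs) | no _ with P? x
... | yes _ = ℕ.m≤n⇒m≤1+n (length-filter-filter P? Q? xs)
... | no _  = length-filter-filter P? Q? xs

length-filter-¬ : {P : Pred A ℓ₃} (P? : Decidable P) → ∀ xs →
                  length (filter P? xs) + length (filter (¬? ∘ P?) xs) ≡ length xs
length-filter-¬ P? []       = refl
length-filter-¬ P? (x ∷ xs) with P? x
... | yes _ = cong suc (length-filter-¬ P? xs)
... | no _  = trans (ℕ.+-suc _ _) (cong suc (length-filter-¬ P? xs))

-- The union bound, with the class sizes scaled by `w` so that `K / w` need not be an integer. It
-- serves both for summing over the possible partners of a vertex and for summing over colourings.
length-cover : {P : B → Pred A ℓ₃} (P? : ∀ y → Decidable (P y)) → ∀ w K ys xs →
               (∀ {x} → x ∈ₗ xs → ∃ λ y → y ∈ₗ ys × P y x) →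
               (∀ {y} → y ∈ₗ ys → length (filter (P? y) xs) *ⁿ w ≤ K) →
               length xs *ⁿ w ≤ length ys *ⁿ K
length-cover P? w K []       []       cov le = z≤n
length-cover P? w K []       (x ∷ xs) cov le with cov (here refl)
... | _ , () , _
length-cover {P = P} P? w K (y ∷ ys) xs cov le = begin
  length xs *ⁿ w                                   ≡⟨ cong (_*ⁿ w) (length-filter-¬ (P? y) xs) ⟨
  (length (filter (P? y) xs) + length rest) *ⁿ w   ≡⟨ ℕ.*-distribʳ-+ w (length (filter (P? y) xs)) _ ⟩
  length (filter (P? y) xs) *ⁿ w + length rest *ⁿ w
    ≤⟨ ℕ.+-mono-≤ (le (here refl)) (length-cover P? w K ys rest cov′ le′) ⟩
  K + length ys *ⁿ K ∎
  where
  open ℕ.≤-Reasoning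
  rest = filter (¬? ∘ P? y) xs
  cov′ : ∀ {x} → x ∈ₗ rest → ∃ λ y → y ∈ₗ ys × P y x
  cov′ x∈ with ∈-filter⁻ (¬? ∘ P? y) {xs = xs} x∈
  ... | x∈xs , ¬Pyx with cov x∈xs
  ... | _  , here refl , Pyx  = contradiction Pyx ¬Pyx
  ... | y′ , there y′∈ , Py′x = y′ , y′∈ , Py′x
  le′ : ∀ {y′} → y′ ∈ₗ ys → length (filter (P? y′) rest) *ⁿ w ≤ K
  le′ {y′} y′∈ = ℕ.≤-trans
    (ℕ.*-monoˡ-≤ w (length-filter-filter (P? y′) (¬? ∘ P? y) xs)) (le (there y′∈))

all-equal⇒length≤1 : {xs : List A} → Unique xs →
                     (∀ {x y} → x ∈ₗ xs → y ∈ₗ xs → x ≡ y) → length xs ≤ 1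
all-equal⇒length≤1 {xs = []}         _                eq = z≤n
all-equal⇒length≤1 {xs = _ ∷ []}     _                eq = s≤s z≤n
all-equal⇒length≤1 {xs = _ ∷ _ ∷ _} ((x≢y ∷ _) ∷ _) eq =
  contradiction (eq (here refl) (there (here refl))) x≢y

-- Pigeonhole principle: cover `xs` by the classes of equality with a member of `ys`; without
-- repetitions each class has at most one element.
unique-⊆⇒length≤ : (_≟_ : ∀ (x y : A) → Dec (x ≡ y)) {xs ys : List A} →
                   Unique xs → (∀ {x} → x ∈ₗ xs → x ∈ₗ ys) → length xs ≤ length ys
unique-⊆⇒length≤ _≟_ {xs} {ys} xs! xs⊆ys = begin
  length xs       ≡⟨ ℕ.*-identityʳ _ ⟨
  length xs *ⁿ 1  ≤⟨ length-cover (λ y x → x ≟ y) 1 1 ys xs (λ {x} x∈ → x , xs⊆ys x∈ , refl) single ⟩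
  length ys *ⁿ 1  ≡⟨ ℕ.*-identityʳ _ ⟩
  length ys       ∎
  where
  open ℕ.≤-Reasoning
  single : ∀ {y} → y ∈ₗ ys → length (filter (_≟ y) xs) *ⁿ 1 ≤ 1
  single {y} _ = ℕ.≤-trans (ℕ.≤-reflexive (ℕ.*-identityʳ _))
    (all-equal⇒length≤1 (Unique.filter⁺ (_≟ y) xs!) λ x∈ z∈ →
      trans (proj₂ (∈-filter⁻ (_≟ y) {xs = xs} x∈)) (sym (proj₂ (∈-filter⁻ (_≟ y) {xs = xs} z∈))))

∈⇒↭ : ∀ {x : A} {xs} → x ∈ₗ xs → ∃ λ ys → xs ↭ x ∷ ys
∈⇒↭ {x = x} x∈ with ∈-∃++ x∈
... | ys , zs , refl = ys ++ zs , shift x ys zs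

-- Double factorials and the cost of splitting a vertex set

-- (s − 1)!! for even s and 0 for odd s.

matchingCount : ℕ → ℕ
matchingCount 0             = 1
matchingCount 1             = 0
matchingCount (suc (suc s)) = suc s *ⁿ matchingCount s

-- The recursion as it arises from revealing one edge: `s` candidates for the partner, then one
-- vertex fewer. At 0 the value of `pred` is harmless, since the factor `s` vanishes.
matchingCount-suc : ∀ s → matchingCount (suc s) ≡ s *ⁿ matchingCount (pred s)
matchingCount-suc zero    = refl
matchingCount-suc (suc s) = refl

matchingCount-+ : ∀ a b → matchingCount a *ⁿ matchingCount b ≤ matchingCount (a + b)
matchingCount-+ 0             b = ℕ.≤-reflexive (ℕ.*-identityˡ _)
matchingCount-+ 1             b = z≤n
matchingCount-+ (suc (suc a)) b = begin
  suc a *ⁿ matchingCount a *ⁿ matchingCount b   ≡⟨ ℕ.*-assoc (suc a) (matchingCount a) _ ⟩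
  suc a *ⁿ (matchingCount a *ⁿ matchingCount b)
    ≤⟨ ℕ.*-mono-≤ (s≤s (ℕ.m≤m+n a b)) (matchingCount-+ a b) ⟩
  suc (a + b) *ⁿ matchingCount (a + b)          ∎
  where open ℕ.≤-Reasoning

private
  -- Once the smaller variable is split off, the difference of the two sides is a polynomial with
  -- nonnegative coefficients. Its constant term is 0: at `a = b = 0` both sides are 15, so 5 is the
  -- best constant, although for large arguments 27/4 is approached.
  step-ratio : ∀ a b → 5 *ⁿ (suc a *ⁿ (suc b *ⁿ (3 + b))) ≤
               (5 + (a + b)) *ⁿ ((3 + (a + b)) *ⁿ suc (a + b))
  step-ratio a b with ℕ.≤-total a b
  ... | inj₁ a≤b with ℕ.m≤n⇒∃[o]m+o≡n a≤b
  ...   | d , refl = ℕ.≤-trans (ℕ.m≤m+n _ _) (ℕ.≤-reflexive (identity a d))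
    where
    open +-*-Solver
    identity : ∀ a d → 5 *ⁿ (suc a *ⁿ (suc (a + d) *ⁿ (3 + (a + d)))) +
      (3 *ⁿ a *ⁿ a *ⁿ a + 2 *ⁿ a *ⁿ a *ⁿ d + a *ⁿ d *ⁿ d + d *ⁿ d *ⁿ d
        + 11 *ⁿ a *ⁿ a + 6 *ⁿ a *ⁿ d + 4 *ⁿ d *ⁿ d + 11 *ⁿ a + 3 *ⁿ d)
      ≡ (5 + (a + (a + d))) *ⁿ ((3 + (a + (a + d))) *ⁿ suc (a + (a + d)))
    identity = solve 2 (λ a d →
      con 5 :* ((con 1 :+ a) :* ((con 1 :+ (a :+ d)) :* (con 3 :+ (a :+ d)))) :+
      (con 3 :* a :* a :* a :+ con 2 :* a :* a :* d :+ a :* d :* d :+ d :* d :* d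
        :+ con 11 :* a :* a :+ con 6 :* a :* d :+ con 4 :* d :* d :+ con 11 :* a :+ con 3 :* d)
      := (con 5 :+ (a :+ (a :+ d))) :* ((con 3 :+ (a :+ (a :+ d))) :* (con 1 :+ (a :+ (a :+ d))))) refl
  step-ratio a b | inj₂ b≤a with ℕ.m≤n⇒∃[o]m+o≡n b≤a
  ...   | d , refl = ℕ.≤-trans (ℕ.m≤m+n _ _) (ℕ.≤-reflexive (identity b d))
    where
    open +-*-Solver
    identity : ∀ b d → 5 *ⁿ (suc (b + d) *ⁿ (suc b *ⁿ (3 + b))) +
      (3 *ⁿ b *ⁿ b *ⁿ b + 7 *ⁿ b *ⁿ b *ⁿ d + 6 *ⁿ b *ⁿ d *ⁿ d + d *ⁿ d *ⁿ d
        + 11 *ⁿ b *ⁿ b + 16 *ⁿ b *ⁿ d + 9 *ⁿ d *ⁿ d + 11 *ⁿ b + 8 *ⁿ d)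
      ≡ (5 + (b + d + b)) *ⁿ ((3 + (b + d + b)) *ⁿ suc (b + d + b))
    identity = solve 2 (λ b d →
      con 5 :* ((con 1 :+ (b :+ d)) :* ((con 1 :+ b) :* (con 3 :+ b))) :+
      (con 3 :* b :* b :* b :+ con 7 :* b :* b :* d :+ con 6 :* b :* d :* d :+ d :* d :* d
        :+ con 11 :* b :* b :+ con 16 :* b :* d :+ con 9 :* d :* d :+ con 11 :* b :+ con 8 :* d)
      := (con 5 :+ (b :+ d :+ b)) :* ((con 3 :+ (b :+ d :+ b)) :* (con 1 :+ (b :+ d :+ b)))) refl

  matchingCount-step : ∀ a b x →
    matchingCount a *ⁿ matchingCount b *ⁿ x ≤ matchingCount (a + b) →
    matchingCount (2 + a) *ⁿ matchingCount (4 + b) *ⁿ (5 *ⁿ x) ≤ matchingCount (6 + (a + b))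
  matchingCount-step a b x le = begin
    suc a *ⁿ D a *ⁿ ((3 + b) *ⁿ (suc b *ⁿ D b)) *ⁿ (5 *ⁿ x)
      ≡⟨ rearrange a (D a) b (D b) x ⟩
    5 *ⁿ (suc a *ⁿ (suc b *ⁿ (3 + b))) *ⁿ (D a *ⁿ D b *ⁿ x)
      ≤⟨ ℕ.*-mono-≤ (step-ratio a b) le ⟩
    (5 + (a + b)) *ⁿ ((3 + (a + b)) *ⁿ suc (a + b)) *ⁿ D (a + b)
      ≡⟨ ℕ.*-assoc (5 + (a + b)) ((3 + (a + b)) *ⁿ suc (a + b)) (D (a + b)) ⟩
    (5 + (a + b)) *ⁿ ((3 + (a + b)) *ⁿ suc (a + b) *ⁿ D (a + b))
      ≡⟨ cong ((5 + (a + b)) *ⁿ_) (ℕ.*-assoc (3 + (a + b)) (suc (a + b)) (D (a + b))) ⟩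
    D (6 + (a + b)) ∎
    where
    open ℕ.≤-Reasoning
    open +-*-Solver
    D = matchingCount
    rearrange : ∀ a u b v x → suc a *ⁿ u *ⁿ ((3 + b) *ⁿ (suc b *ⁿ v)) *ⁿ (5 *ⁿ x) ≡
      5 *ⁿ (suc a *ⁿ (suc b *ⁿ (3 + b))) *ⁿ (u *ⁿ v *ⁿ x)
    rearrange = solve 5 (λ a u b v x →
      (con 1 :+ a) :* u :* ((con 3 :+ b) :* ((con 1 :+ b) :* v)) :* (con 5 :* x) :=
      con 5 :* ((con 1 :+ a) :* ((con 1 :+ b) :* (con 3 :+ b))) :* (u :* v :* x)) refl

-- Removing 2 vertices from the smaller and 4 from the larger side costs a factor of at
-- least 5 and keeps the hypotheses.

matchingCount-split : ∀ q a b → 2 *ⁿ q ≤ a → 2 *ⁿ q ≤ b → 6 *ⁿ q ≤ a + b →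
                      matchingCount a *ⁿ matchingCount b *ⁿ 5 ^ q ≤ matchingCount (a + b)
private
  split-ordered : ∀ q a b → a ≤ b → 2 *ⁿ suc q ≤ a → 6 *ⁿ suc q ≤ a + b →
                  matchingCount a *ⁿ matchingCount b *ⁿ 5 ^ suc q ≤ matchingCount (a + b)

matchingCount-split zero a b _ _ _ =
  ℕ.≤-trans (ℕ.≤-reflexive (ℕ.*-identityʳ _)) (matchingCount-+ a b)
matchingCount-split (suc q) a b qa qb qab with ℕ.≤-total a b
... | inj₁ a≤b = split-ordered q a b a≤b qa qab
... | inj₂ b≤a = begin
  D a *ⁿ D b *ⁿ 5 ^ suc q ≡⟨ cong (_*ⁿ 5 ^ suc q) (ℕ.*-comm (D a) (D b)) ⟩
  D b *ⁿ D a *ⁿ 5 ^ suc q ≤⟨ split-ordered q b a b≤a qb (subst (6 *ⁿ suc q ≤_) (ℕ.+-comm a b) qab) ⟩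
  D (b + a)                ≡⟨ cong D (ℕ.+-comm b a) ⟩
  D (a + b)                ∎
  where
  open ℕ.≤-Reasoning
  D = matchingCount

split-ordered q a b a≤b qa qab = go a b a≤b (subst (_≤ a) (ℕ.*-suc 2 q) qa)
                                           (subst (_≤ a + b) (ℕ.*-suc 6 q) qab)
  where
  D = matchingCount
  go : ∀ a b → a ≤ b → 2 + 2 *ⁿ q ≤ a → 6 + 6 *ⁿ q ≤ a + b →
       D a *ⁿ D b *ⁿ 5 ^ suc q ≤ D (a + b)
  -- Two sides of at most 2 vertices cannot have the 6 vertices that `suc q` demands.
  go (suc (suc a)) 2 le₁ le₂ le₃ with ℕ.≤-trans le₃ (ℕ.+-monoˡ-≤ 2 le₁)
  ... | s≤s (s≤s (s≤s (s≤s ())))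
  -- An odd side has no perfect matching: `D 3` is 0.
  go (suc (suc a)) 3 le₁ le₂ le₃ = ℕ.≤-trans
    (ℕ.≤-reflexive (cong (_*ⁿ 5 ^ suc q) (ℕ.*-zeroʳ (D (2 + a))))) z≤n
  go 1 (suc b) _ (s≤s ()) _
  go (suc (suc a)) 1 (s≤s ()) _ _
  go (suc (suc a)) (suc (suc (suc (suc b)))) (s≤s (s≤s le₁)) (s≤s (s≤s le₂)) le₃ =
    subst (λ s → D (2 + a) *ⁿ D (4 + b) *ⁿ 5 ^ suc q ≤ D (2 + s)) (sym assoc)
      (matchingCount-step a b (5 ^ q)
        (matchingCount-split q a b le₂ (large q tripled) sum))
    where
    open +-*-Solver
    assoc : a + (4 + b) ≡ 4 + (a + b)
    assoc = solve 2 (λ a b → a :+ (con 4 :+ b) := con 4 :+ (a :+ b)) refl a b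
    sum : 6 *ⁿ q ≤ a + b
    sum = ℕ.+-cancelˡ-≤ 6 _ _ (subst (λ s → 6 + 6 *ⁿ q ≤ 2 + s) assoc le₃)
    -- After the removal the former larger side may be the smaller one by up to 2, so it has almost
    -- half of the at least `6 * q` vertices. For positive `q` this exceeds what `2 * q ≤ b` asks.
    tripled : 3 *ⁿ q ≤ suc b
    tripled = ℕ.*-cancelˡ-≤ 2 (begin
      2 *ⁿ (3 *ⁿ q) ≡⟨ ℕ.*-assoc 2 3 q ⟨
      6 *ⁿ q        ≤⟨ sum ⟩
      a + b         ≤⟨ ℕ.+-monoˡ-≤ b le₁ ⟩
      2 + b + b     ≡⟨ solve 1 (λ b → con 2 :+ b :+ b := con 2 :* (con 1 :+ b)) refl b ⟩
      2 *ⁿ suc b    ∎)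
      where open ℕ.≤-Reasoning
    large : ∀ q → 3 *ⁿ q ≤ suc b → 2 *ⁿ q ≤ b
    large zero    _  = z≤n
    large (suc q) le = s≤s⁻¹ (ℕ.≤-trans (ℕ.+-monoˡ-≤ (2 *ⁿ suc q) (s≤s z≤n)) le)

-- Perfect matchings and colourings

∣p∣≡0⇒p≡⊥ : (p : Subset n) → ∣ p ∣ ≡ 0 → p ≡ ⊥
∣p∣≡0⇒p≡⊥ []          _  = refl
∣p∣≡0⇒p≡⊥ (false ∷ p) eq = cong (false ∷_) (∣p∣≡0⇒p≡⊥ p eq)

∣p∣≡1∧x∈p⇒p≡⁅x⁆ : ∀ {p : Subset n} {x} → ∣ p ∣ ≡ 1 → x ∈ p → p ≡ ⁅ x ⁆
∣p∣≡1∧x∈p⇒p≡⁅x⁆ {p = true ∷ p}  eq here       = cong (true ∷_) (∣p∣≡0⇒p≡⊥ p (ℕ.suc-injective eq))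
∣p∣≡1∧x∈p⇒p≡⁅x⁆ {p = true ∷ p}  eq (there x∈) =
  contradiction (subst (_ ∈_) (∣p∣≡0⇒p≡⊥ p (ℕ.suc-injective eq)) x∈) Subset.∉⊥
∣p∣≡1∧x∈p⇒p≡⁅x⁆ {p = false ∷ p} eq (there x∈) = cong (false ∷_) (∣p∣≡1∧x∈p⇒p≡⁅x⁆ eq x∈)

∣p∣≡1⇒nonempty : (p : Subset n) → ∣ p ∣ ≡ 1 → ∃ (_∈ p)
∣p∣≡1⇒nonempty (true  ∷ p) eq = _ , here
∣p∣≡1⇒nonempty (false ∷ p) eq with ∣p∣≡1⇒nonempty p eq
... | x , x∈ = _ , there x∈

lookup-ext : ∀ {a} {A : Set a} (u v : Vec A n) → (∀ x → lookup u x ≡ lookup v x) → u ≡ v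
lookup-ext u v eq = trans (sym (Vec.tabulate∘lookup u))
  (trans (Vec.tabulate-cong eq) (Vec.tabulate∘lookup v))

neighbour : (M : Graph n) → IsPerfectMatching M → ∀ x → ∃ (Adj M x)
neighbour M (_ , one) x = ∣p∣≡1⇒nonempty (lookup M x) (one x)

neighbour-unique : (M : Graph n) → IsPerfectMatching M → ∀ {x y z} →
                   Adj M x y → Adj M x z → y ≡ z
neighbour-unique M (_ , one) {x} {y} {z} xy xz =
  Subset.x∈⁅y⁆⇒x≡y z (subst (y ∈_) (∣p∣≡1∧x∈p⇒p≡⁅x⁆ (one x) xz) xy)

data Colour : Set where
  separator left right : Colour

_≟ᶜ_ : (c d : Colour) → Dec (c ≡ d)
separator ≟ᶜ separator = yes refl
separator ≟ᶜ left      = no λ ()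
separator ≟ᶜ right     = no λ ()
left      ≟ᶜ separator = no λ ()
left      ≟ᶜ left      = yes refl
left      ≟ᶜ right     = no λ ()
right     ≟ᶜ separator = no λ ()
right     ≟ᶜ left      = no λ ()
right     ≟ᶜ right     = yes refl

Colouring : ℕ → Set
Colouring = Vec Colour

Separates : Colouring n → Graph n → Set
Separates χ G = ∀ x y → Adj G x y → lookup χ x ≡ left → lookup χ y ≢ right

separates? : (χ : Colouring n) → Decidable (Separates χ)
separates? χ G = Fin.all? λ x → Fin.all? λ y →
  adj? G x y →-dec (lookup χ x ≟ᶜ left →-dec ¬? (lookup χ y ≟ᶜ right))

coloured : Colouring n → Colour → List (Fin n) → List (Fin n)
coloured χ k = filter (λ x → lookup χ x ≟ᶜ k)

# : Colouring n → Colour → List (Fin n) → ℕ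
# χ k L = length (coloured χ k L)

-- Revealing a matching edge by edge, for a fixed colouring

Unique-resp-↭ : ∀ {a} {A : Set a} {xs ys : List A} → xs ↭ ys → Unique xs → Unique ys
Unique-resp-↭ {A = A} σ = Permutation.Unique-resp-↭ (setoid A) (↭⇒↭ₛ σ)

module _ (χ : Colouring n) where

  #-↭ : ∀ k {L L′} → L ↭ L′ → # χ k L ≡ # χ k L′
  #-↭ k σ = ↭-length (filter-↭ (λ x → lookup χ x ≟ᶜ k) σ)

  #-≡ : ∀ {k v} L → lookup χ v ≡ k → # χ k (v ∷ L) ≡ suc (# χ k L)
  #-≡ {k} L eq = cong length (filter-accept (λ x → lookup χ x ≟ᶜ k) eq)

  #-≢ : ∀ {k v} L → lookup χ v ≢ k → # χ k (v ∷ L) ≡ # χ k L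
  #-≢ {k} L neq = cong length (filter-reject (λ x → lookup χ x ≟ᶜ k) neq)

  ∈⇒#≢0 : ∀ {k v} L → v ∈ₗ L → lookup χ v ≡ k → # χ k L ≢ 0
  ∈⇒#≢0 {k} L v∈ eq #≡0 with coloured χ k L | ∈-filter⁺ (λ x → lookup χ x ≟ᶜ k) v∈ eq
  ... | _ ∷ _ | _ = contradiction #≡0 λ ()

  pick : ∀ k L {s} → # χ k L ≡ suc s →
         ∃ λ v → ∃ λ L′ → L ↭ v ∷ L′ × lookup χ v ≡ k
  pick k L eq with coloured χ k L in eq′
  ... | v ∷ _ with ∈-filter⁻ (λ x → lookup χ x ≟ᶜ k) {xs = L} (subst (v ∈ₗ_) (sym eq′) (here refl))
  ...   | v∈ , χv≡k with ∈⇒↭ v∈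
  ...     | L′ , σ = v , L′ , σ , χv≡k

  #-total : ∀ L → # χ separator L + (# χ left L + # χ right L) ≡ length L
  #-total []      = refl
  #-total (v ∷ L) with lookup χ v | #-total L
  ... | separator | eq = cong suc eq
  ... | left      | eq = trans (ℕ.+-suc _ _) (cong suc eq)
  ... | right     | eq = trans (cong (# χ separator L +_) (ℕ.+-suc _ _)) (trans (ℕ.+-suc _ _) (cong suc eq))

  -- Matchings with the same edges outside L: what remains to be revealed is how they pair
  -- off the vertices of L.

  record Family (L : List (Fin n)) (Ms : List (Graph n)) : Set where
    field
      unique   : Unique Ms
      perfect  : ∀ {M} → M ∈ₗ Ms → IsPerfectMatching M
      separate : ∀ {M} → M ∈ₗ Ms → Separates χ M
      closed   : ∀ {M x y} → M ∈ₗ Ms → x ∈ₗ L → Adj M x y → y ∈ₗ L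
      agree    : ∀ {M N x} → M ∈ₗ Ms → N ∈ₗ Ms → ¬ x ∈ₗ L → lookup M x ≡ lookup N x

  open Family

  family-∅ : ∀ {Ms} → Family [] Ms → length Ms ≤ 1
  family-∅ F = all-equal⇒length≤1 (unique F) λ {M} {N} M∈ N∈ →
    lookup-ext M N λ x → agree F M∈ N∈ λ ()

  -- Fixing the edge between `v` and `y` determines both of their rows, which gives agreement
  -- outside `L″`; and no vertex of `L″` can have `v` or `y` as its partner, which keeps `L″`
  -- closed.
  family-remove : ∀ {L L″ v y Ms} → Unique L → L ↭ v ∷ y ∷ L″ → Family L Ms →
                  Family L″ (filter (λ M → adj? M v y) Ms)
  family-remove {L} {L″} {v} {y} {Ms} L! σ F = record
    { unique   = Unique.filter⁺ vy? (unique F)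
    ; perfect  = perfect F ∘ proj₁ ∘ ∈Ms
    ; separate = separate F ∘ proj₁ ∘ ∈Ms
    ; closed   = λ M∈ x∈ xz → let M∈Ms , vy = ∈Ms M∈ in
        closed′ M∈Ms vy x∈ xz (∈-resp-↭ σ (closed F M∈Ms (∈-resp-↭ (↭-sym σ) (there (there x∈))) xz))
    ; agree    = λ M∈ N∈ → agree′ (∈Ms M∈) (∈Ms N∈)
    }
    where
    vy? = λ M → adj? M v y
    ∈Ms : ∀ {M} → M ∈ₗ filter vy? Ms → M ∈ₗ Ms × Adj M v y
    ∈Ms = ∈-filter⁻ vy? {xs = Ms}
    v∉ : ∀ {x} → x ∈ₗ y ∷ L″ → v ≢ x
    v∉ x∈ with Unique-resp-↭ σ L!
    ... | v∉ ∷ _ = All.lookup v∉ x∈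
    y∉ : ∀ {x} → x ∈ₗ L″ → y ≢ x
    y∉ x∈ with Unique-resp-↭ σ L!
    ... | _ ∷ y∉ ∷ _ = All.lookup y∉ x∈
    flip : ∀ {M} → M ∈ₗ Ms → ∀ {a b} → Adj M a b → Adj M b a
    flip M∈ {a} {b} = proj₁ (proj₁ (perfect F M∈)) a b
    closed′ : ∀ {M x z} → M ∈ₗ Ms → Adj M v y → x ∈ₗ L″ → Adj M x z → z ∈ₗ v ∷ y ∷ L″ → z ∈ₗ L″
    closed′ {M} M∈ vy x∈ xz (here refl) =
      contradiction (neighbour-unique M (perfect F M∈) vy (flip M∈ xz)) (y∉ x∈)
    closed′ {M} M∈ vy x∈ xz (there (here refl)) =
      contradiction (neighbour-unique M (perfect F M∈) (flip M∈ vy) (flip M∈ xz)) (v∉ (there x∈))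
    closed′ M∈ vy x∈ xz (there (there z∈)) = z∈
    agree′ : ∀ {M N x} → M ∈ₗ Ms × Adj M v y → N ∈ₗ Ms × Adj N v y →
             ¬ x ∈ₗ L″ → lookup M x ≡ lookup N x
    agree′ {x = x} (M∈ , vyM) (N∈ , vyN) x∉ with x Fin.≟ v | x Fin.≟ y
    ... | yes refl | _ = trans (∣p∣≡1∧x∈p⇒p≡⁅x⁆ (proj₂ (perfect F M∈) v) vyM)
                           (sym (∣p∣≡1∧x∈p⇒p≡⁅x⁆ (proj₂ (perfect F N∈) v) vyN))
    ... | no _ | yes refl = trans (∣p∣≡1∧x∈p⇒p≡⁅x⁆ (proj₂ (perfect F M∈) y) (flip M∈ vyM))
                              (sym (∣p∣≡1∧x∈p⇒p≡⁅x⁆ (proj₂ (perfect F N∈) y) (flip N∈ vyN)))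
    ... | no x≢v | no x≢y = agree F M∈ N∈ λ x∈L → other (∈-resp-↭ σ x∈L)
      where
      other : ¬ x ∈ₗ v ∷ y ∷ L″
      other (here eq)           = x≢v eq
      other (there (here eq))   = x≢y eq
      other (there (there x∈)) = x∉ x∈

  -- Classifies the matchings by the partner of `v`. Closedness puts the partner in `L` and
  -- irreflexivity in `L′`; `ys` are the candidates that the colouring leaves, and each class is a
  -- family with two vertices fewer.
  family-branch : ∀ {L L′ v Ms} ys w K → Unique L → L ↭ v ∷ L′ → Family L Ms →
    (∀ {M y} → M ∈ₗ Ms → Adj M v y → y ∈ₗ L′ → y ∈ₗ ys) →
    (∀ {y} → y ∈ₗ ys → y ∈ₗ L′) →
    (∀ {y L″ Ms′} → y ∈ₗ ys → L′ ↭ y ∷ L″ → Unique L″ → Family L″ Ms′ → length Ms′ *ⁿ w ≤ K) →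
    length Ms *ⁿ w ≤ length ys *ⁿ K
  family-branch {L} {L′} {v} {Ms} ys w K L! σ F into ys⊆L′ bound =
    length-cover (λ y M → adj? M v y) w K ys Ms cover piece
    where
    cover : ∀ {M} → M ∈ₗ Ms → ∃ λ y → y ∈ₗ ys × Adj M v y
    cover {M} M∈ with neighbour M (perfect F M∈) v
    ... | y , vy with ∈-resp-↭ σ (closed F M∈ (∈-resp-↭ (↭-sym σ) (here refl)) vy)
    ...   | here refl = contradiction vy (proj₂ (proj₁ (perfect F M∈)) v)
    ...   | there y∈  = y , into M∈ vy y∈ , vy
    piece : ∀ {y} → y ∈ₗ ys → length (filter (λ M → adj? M v y) Ms) *ⁿ w ≤ K
    piece y∈ with ∈⇒↭ (ys⊆L′ y∈)
    ... | L″ , τ with Unique-resp-↭ (↭-trans σ (prep v τ)) L!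
    ...   | _ ∷ _ ∷ L″! = bound y∈ τ L″! (family-remove L! (↭-trans σ (prep v τ)) F)

  private
    D = matchingCount

    #-step-≡ : ∀ {k L v L′ s} → # χ k L ≡ suc s → L ↭ v ∷ L′ → lookup χ v ≡ k → # χ k L′ ≡ s
    #-step-≡ {k} {L′ = L′} eq σ χv = ℕ.suc-injective
      (trans (sym (trans (#-↭ k σ) (#-≡ L′ χv))) eq)

    #-step-≢ : ∀ {k L v L′ s} → # χ k L ≡ s → L ↭ v ∷ L′ → lookup χ v ≢ k → # χ k L′ ≡ s
    #-step-≢ {k} {L′ = L′} eq σ χv = trans (sym (trans (#-↭ k σ) (#-≢ L′ χv))) eq

    ≢-by : ∀ {c d e : Colour} → c ≡ d → d ≢ e → c ≢ e
    ≢-by refl d≢e = d≢e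

  -- The left vertices are revealed first, `Separates` confining their partners to the left. When
  -- none remain, every vertex still unmatched is right, so the second half is unrestricted
  -- matching.
  count-separated : ∀ a b {L Ms} → # χ separator L ≡ 0 → # χ left L ≡ a → # χ right L ≡ b →
                    Unique L → Family L Ms → length Ms *ⁿ 1 ≤ D a *ⁿ D b
  count-separated 0 0 {[]} #s #l #r L! F =
    ℕ.≤-trans (ℕ.≤-reflexive (ℕ.*-identityʳ _)) (family-∅ F)
  count-separated 0 0 {v ∷ L} #s #l #r L! F
    with trans (sym (#-total (v ∷ L))) (cong₂ _+_ #s (cong₂ _+_ #l #r))
  ... | ()
  count-separated 0 (suc b) {L} {Ms} #s #l #r L! F with pick right L #r
  ... | v , L′ , σ , χv = begin
    length Ms *ⁿ 1                  ≤⟨ family-branch ys 1 (D (pred b)) L! σ F into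
                                         (proj₁ ∘ ∈-filter⁻ right? {xs = L′}) (bound b #r′) ⟩
    length ys *ⁿ D (pred b)         ≡⟨ cong (_*ⁿ D (pred b)) #r′ ⟩
    b *ⁿ D (pred b)                 ≡⟨ matchingCount-suc b ⟨
    D (suc b)                       ≡⟨ ℕ.*-identityˡ _ ⟨
    1 *ⁿ D (suc b)                  ∎
    where
    open ℕ.≤-Reasoning
    right? = λ x → lookup χ x ≟ᶜ right
    ys = coloured χ right L′
    #r′ = #-step-≡ #r σ χv
    #s′ = #-step-≢ #s σ (≢-by χv λ ())
    #l′ = #-step-≢ #l σ (≢-by χv λ ())
    into : ∀ {M y} → M ∈ₗ Ms → Adj M v y → y ∈ₗ L′ → y ∈ₗ ys
    into {y = y} M∈ vy y∈ with lookup χ y in χy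
    ... | separator = contradiction #s′ (∈⇒#≢0 L′ y∈ χy)
    ... | left      = contradiction #l′ (∈⇒#≢0 L′ y∈ χy)
    ... | right     = ∈-filter⁺ right? y∈ χy
    bound : ∀ b → # χ right L′ ≡ b → ∀ {y L″ Ms′} → y ∈ₗ ys → L′ ↭ y ∷ L″ → Unique L″ →
            Family L″ Ms′ → length Ms′ *ⁿ 1 ≤ D (pred b)
    bound b #r′ y∈ τ L″! F′ with ∈-filter⁻ right? {xs = L′} y∈
    bound zero     #r′ y∈ τ L″! F′ | y∈L′ , χy = contradiction #r′ (∈⇒#≢0 L′ y∈L′ χy)
    bound (suc b′) #r′ y∈ τ L″! F′ | y∈L′ , χy = ℕ.≤-trans
      (count-separated 0 b′ (#-step-≢ #s′ τ (≢-by χy λ ())) (#-step-≢ #l′ τ (≢-by χy λ ()))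
        (#-step-≡ #r′ τ χy) L″! F′) (ℕ.≤-reflexive (ℕ.*-identityˡ _))
  count-separated (suc a) b {L} {Ms} #s #l #r L! F with pick left L #l
  ... | v , L′ , σ , χv = begin
    length Ms *ⁿ 1                  ≤⟨ family-branch ys 1 (D (pred a) *ⁿ D b) L! σ F into
                                         (proj₁ ∘ ∈-filter⁻ left? {xs = L′}) (bound a #l′) ⟩
    length ys *ⁿ (D (pred a) *ⁿ D b) ≡⟨ cong (_*ⁿ (D (pred a) *ⁿ D b)) #l′ ⟩
    a *ⁿ (D (pred a) *ⁿ D b)         ≡⟨ ℕ.*-assoc a (D (pred a)) (D b) ⟨
    a *ⁿ D (pred a) *ⁿ D b           ≡⟨ cong (_*ⁿ D b) (matchingCount-suc a) ⟨
    D (suc a) *ⁿ D b                 ∎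
    where
    open ℕ.≤-Reasoning
    left? = λ x → lookup χ x ≟ᶜ left
    ys = coloured χ left L′
    #l′ = #-step-≡ #l σ χv
    #s′ = #-step-≢ #s σ (≢-by χv λ ())
    #r′ = #-step-≢ #r σ (≢-by χv λ ())
    into : ∀ {M y} → M ∈ₗ Ms → Adj M v y → y ∈ₗ L′ → y ∈ₗ ys
    into {y = y} M∈ vy y∈ with lookup χ y in χy
    ... | separator = contradiction #s′ (∈⇒#≢0 L′ y∈ χy)
    ... | left      = ∈-filter⁺ left? y∈ χy
    ... | right     = contradiction χy (separate F M∈ v y vy χv)
    bound : ∀ a → # χ left L′ ≡ a → ∀ {y L″ Ms′} → y ∈ₗ ys → L′ ↭ y ∷ L″ → Unique L″ →
            Family L″ Ms′ → length Ms′ *ⁿ 1 ≤ D (pred a) *ⁿ D b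
    bound a #l′ y∈ τ L″! F′ with ∈-filter⁻ left? {xs = L′} y∈
    bound zero     #l′ y∈ τ L″! F′ | y∈L′ , χy = contradiction #l′ (∈⇒#≢0 L′ y∈L′ χy)
    bound (suc a′) #l′ y∈ τ L″! F′ | y∈L′ , χy = count-separated a′ b (#-step-≢ #s′ τ (≢-by χy λ ()))
                     (#-step-≡ #l′ τ χy) (#-step-≢ #r′ τ (≢-by χy λ ())) L″! F′

  -- The partner of a separator vertex is bounded trivially: this costs the same factor s − 1
  -- as in (s − 1)!!.

  count-separating : ∀ q c a b {L Ms} → # χ separator L ≡ c → # χ left L ≡ a → # χ right L ≡ b →
                     2 *ⁿ q + c ≤ a → 2 *ⁿ q + c ≤ b → 6 *ⁿ q + c ≤ a + b →
                     Unique L → Family L Ms → length Ms *ⁿ 5 ^ q ≤ D (c + (a + b))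
  count-separating q zero a b {L} {Ms} #s #l #r qa qb qab L! F = begin
    length Ms *ⁿ 5 ^ q         ≡⟨ cong (_*ⁿ 5 ^ q) (ℕ.*-identityʳ (length Ms)) ⟨
    length Ms *ⁿ 1 *ⁿ 5 ^ q    ≤⟨ ℕ.*-monoˡ-≤ (5 ^ q) (count-separated a b #s #l #r L! F) ⟩
    D a *ⁿ D b *ⁿ 5 ^ q        ≤⟨ matchingCount-split q a b (drop qa) (drop qb) (drop qab) ⟩
    D (a + b)                  ∎
    where
    open ℕ.≤-Reasoning
    drop : ∀ {x y} → x + 0 ≤ y → x ≤ y
    drop = ℕ.≤-trans (ℕ.≤-reflexive (sym (ℕ.+-identityʳ _)))
  count-separating q (suc c) a b {L} {Ms} #s #l #r qa qb qab L! F with pick separator L #s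
  ... | v , L′ , σ , χv = begin
    length Ms *ⁿ 5 ^ q                       ≤⟨ family-branch L′ (5 ^ q) _ L! σ F (λ _ _ y∈ → y∈)
                                                  (λ y∈ → y∈) (bound _ c a b #s′ #l′ #r′ qa qb qab refl) ⟩
    length L′ *ⁿ D (pred (c + (a + b)))      ≡⟨ cong (_*ⁿ D (pred (c + (a + b)))) length-L′ ⟩
    (c + (a + b)) *ⁿ D (pred (c + (a + b)))  ≡⟨ matchingCount-suc (c + (a + b)) ⟨
    D (suc c + (a + b))                      ∎
    where
    open ℕ.≤-Reasoning
    #s′ = #-step-≡ #s σ χv
    #l′ = #-step-≢ #l σ (≢-by χv λ ())
    #r′ = #-step-≢ #r σ (≢-by χv λ ())
    length-L′ : length L′ ≡ c + (a + b)
    length-L′ = trans (sym (#-total L′)) (cong₂ _+_ #s′ (cong₂ _+_ #l′ #r′))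
    less : ∀ {x c y} → x + suc c ≤ suc y → x + c ≤ y
    less {x} {c} {y} le = s≤s⁻¹ (subst (_≤ suc y) (ℕ.+-suc x c) le)
    less₂ : ∀ {x c y} → x + suc (suc c) ≤ y → x + c ≤ y
    less₂ {x} {c} le = ℕ.≤-trans (ℕ.+-monoʳ-≤ x (ℕ.m≤n⇒m≤1+n (ℕ.n≤1+n c))) le
    less₁ : ∀ {x c y} → x + suc c ≤ y → x + c ≤ y
    less₁ {x} {c} le = ℕ.≤-trans (ℕ.+-monoʳ-≤ x (ℕ.n≤1+n c)) le
    -- The partner, of colour `k`, may use up a vertex of either side. The summand `c` in the three
    -- size hypotheses is the budget for this: it drops by one (by two for a separator partner)
    -- while each size drops by at most one.
    bound : ∀ k c a b → # χ separator L′ ≡ c → # χ left L′ ≡ a → # χ right L′ ≡ b →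
            2 *ⁿ q + suc c ≤ a → 2 *ⁿ q + suc c ≤ b → 6 *ⁿ q + suc c ≤ a + b →
            ∀ {y L″ Ms′} → lookup χ y ≡ k → y ∈ₗ L′ → L′ ↭ y ∷ L″ → Unique L″ → Family L″ Ms′ →
            length Ms′ *ⁿ 5 ^ q ≤ D (pred (c + (a + b)))
    bound separator zero a b #s #l #r qa qb qab χy y∈ τ L″! F =
      contradiction #s (∈⇒#≢0 L′ y∈ χy)
    bound separator (suc c) a b #s #l #r qa qb qab χy y∈ τ L″! F =
      count-separating q c a b (#-step-≡ #s τ χy) (#-step-≢ #l τ (≢-by χy λ ()))
        (#-step-≢ #r τ (≢-by χy λ ())) (less₂ qa) (less₂ qb) (less₂ qab) L″! F
    bound left c zero b #s #l #r qa qb qab χy y∈ τ L″! F =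
      contradiction #l (∈⇒#≢0 L′ y∈ χy)
    bound left c (suc a) b #s #l #r qa qb qab {Ms′ = Ms′} χy y∈ τ L″! F =
      subst (λ s → length Ms′ *ⁿ 5 ^ q ≤ D (pred s)) (sym (ℕ.+-suc c (a + b)))
        (count-separating q c a b (#-step-≢ #s τ (≢-by χy λ ())) (#-step-≡ #l τ χy)
          (#-step-≢ #r τ (≢-by χy λ ())) (less qa) (less₁ qb) (less qab) L″! F)
    bound right c a zero #s #l #r qa qb qab χy y∈ τ L″! F =
      contradiction #r (∈⇒#≢0 L′ y∈ χy)
    bound right c a (suc b) #s #l #r qa qb qab {Ms′ = Ms′} χy y∈ τ L″! F =
      subst (λ s → length Ms′ *ⁿ 5 ^ q ≤ D (pred s))
        (sym (trans (cong (c +_) (ℕ.+-suc a b)) (ℕ.+-suc c (a + b))))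
        (count-separating q c a b (#-step-≢ #s τ (≢-by χy λ ())) (#-step-≢ #l τ (≢-by χy λ ()))
          (#-step-≡ #r τ χy) (less₁ qa) (less qb)
          (less (subst (6 *ⁿ q + suc c ≤_) (ℕ.+-suc a b) qab)) L″! F)

-- A lower bound for the number of perfect matchings

map-unique : ∀ {a b} {A : Set a} {B : Set b} (f : A → B) {xs} → Unique xs →
             (∀ {x y} → x ∈ₗ xs → y ∈ₗ xs → f x ≡ f y → x ≡ y) → Unique (map f xs)
map-unique f []         inj = []
map-unique f (x∉ ∷ xs!) inj = All.tabulate fresh ∷ map-unique f xs! (λ x∈ y∈ → inj (there x∈) (there y∈))
  where
  fresh : ∀ {z} → z ∈ₗ map f _ → f _ ≢ z
  fresh z∈ eq with ∈-map⁻ f z∈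
  ... | y , y∈ , refl = All.lookup x∉ y∈ (inj (here refl) (there y∈) eq)

-- Perfect matchings of `L`, kept as graphs on all of `Fin n` with empty rows elsewhere, so that an
-- edge is added by overwriting two empty rows.
record MatchingOn {n} (L : List (Fin n)) (M : Graph n) : Set where
  field
    simple : IsSimple M
    one    : ∀ x → x ∈ₗ L → ∣ lookup M x ∣ ≡ 1
    none   : ∀ x → ¬ x ∈ₗ L → lookup M x ≡ ⊥

open MatchingOn

private
  Adj-∈ : ∀ {L} {M : Graph n} → MatchingOn L M → ∀ {x y} → Adj M x y → ¬ ¬ x ∈ₗ L
  Adj-∈ on {x} xy x∉ = Subset.∉⊥ (subst (_ ∈_) (none on x x∉) xy)

join : Fin n → Fin n → Graph n → Graph n
join v w M = (M [ v ]≔ ⁅ w ⁆) [ w ]≔ ⁅ v ⁆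

module _ {v w : Fin n} (v≢w : v ≢ w) where

  lookup-join₁ : ∀ M → lookup (join v w M) v ≡ ⁅ w ⁆
  lookup-join₁ M = trans (Vec.lookup∘update′ v≢w (M [ v ]≔ ⁅ w ⁆) ⁅ v ⁆) (Vec.lookup∘update v M ⁅ w ⁆)

  lookup-join₂ : ∀ M → lookup (join v w M) w ≡ ⁅ v ⁆
  lookup-join₂ M = Vec.lookup∘update w (M [ v ]≔ ⁅ w ⁆) ⁅ v ⁆

  lookup-join : ∀ M {x} → x ≢ v → x ≢ w → lookup (join v w M) x ≡ lookup M x
  lookup-join M x≢v x≢w =
    trans (Vec.lookup∘update′ x≢w (M [ v ]≔ ⁅ w ⁆) ⁅ v ⁆) (Vec.lookup∘update′ x≢v M ⁅ w ⁆)

  module _ {L : List (Fin n)} (v∉ : ¬ v ∈ₗ L) (w∉ : ¬ w ∈ₗ L) where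

    -- The rows that `join` overwrites are empty in every matching on `L`, so no information is
    -- lost.
    join-injective : ∀ {M N} → MatchingOn L M → MatchingOn L N → join v w M ≡ join v w N → M ≡ N
    join-injective {M} {N} onM onN eq = lookup-ext M N same
      where
      same : ∀ x → lookup M x ≡ lookup N x
      same x with x Fin.≟ v | x Fin.≟ w
      ... | yes refl | _        = trans (none onM v v∉) (sym (none onN v v∉))
      ... | no _     | yes refl = trans (none onM w w∉) (sym (none onN w w∉))
      ... | no x≢v   | no x≢w   = trans (sym (lookup-join M x≢v x≢w))
        (trans (cong (λ G → lookup G x) eq) (lookup-join N x≢v x≢w))

    join-on : ∀ {K M} → K ↭ v ∷ w ∷ L → MatchingOn L M → MatchingOn K (join v w M)
    join-on {K} {M} σ on = record { simple = sym′ , irr ; one = one′ ; none = none′ }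
      where
      G = join v w M
      outside-w : ∀ {x y} → Adj M x y → x ≢ v × x ≢ w
      outside-w xy = (λ where refl → Adj-∈ on xy v∉) , (λ where refl → Adj-∈ on xy w∉)
      sym′ : ∀ x y → Adj G x y → Adj G y x
      sym′ x y xy with x Fin.≟ v | x Fin.≟ w
      ... | yes refl | _ rewrite lookup-join₁ M | Subset.x∈⁅y⁆⇒x≡y w xy =
        subst (v ∈_) (sym (lookup-join₂ M)) (Subset.x∈⁅x⁆ v)
      ... | no _ | yes refl rewrite lookup-join₂ M | Subset.x∈⁅y⁆⇒x≡y v xy =
        subst (w ∈_) (sym (lookup-join₁ M)) (Subset.x∈⁅x⁆ w)
      ... | no x≢v | no x≢w with proj₁ (simple on) x y (subst (y ∈_) (lookup-join M x≢v x≢w) xy)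
      ...   | yx with outside-w yx
      ...     | y≢v , y≢w = subst (x ∈_) (sym (lookup-join M y≢v y≢w)) yx
      irr : ∀ x → ¬ Adj G x x
      irr x xx with x Fin.≟ v | x Fin.≟ w
      ... | yes refl | _ = v≢w (Subset.x∈⁅y⁆⇒x≡y w (subst (v ∈_) (lookup-join₁ M) xx))
      ... | no _ | yes refl = v≢w (sym (Subset.x∈⁅y⁆⇒x≡y v (subst (w ∈_) (lookup-join₂ M) xx)))
      ... | no x≢v | no x≢w = proj₂ (simple on) x (subst (x ∈_) (lookup-join M x≢v x≢w) xx)
      one′ : ∀ x → x ∈ₗ K → ∣ lookup G x ∣ ≡ 1
      one′ x x∈ with x Fin.≟ v | x Fin.≟ w | ∈-resp-↭ σ x∈
      ... | yes refl | _        | _ rewrite lookup-join₁ M = Subset.∣⁅x⁆∣≡1 w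
      ... | no _     | yes refl | _ rewrite lookup-join₂ M = Subset.∣⁅x⁆∣≡1 v
      ... | no x≢v   | no x≢w   | here eq = contradiction eq x≢v
      ... | no x≢v   | no x≢w   | there (here eq) = contradiction eq x≢w
      ... | no x≢v   | no x≢w   | there (there x∈L) =
        trans (cong ∣_∣ (lookup-join M x≢v x≢w)) (one on x x∈L)
      none′ : ∀ x → ¬ x ∈ₗ K → lookup G x ≡ ⊥
      none′ x x∉ = trans
        (lookup-join M (λ eq → x∉′ (here eq)) (λ eq → x∉′ (there (here eq))))
        (none on x (λ x∈ → x∉′ (there (there x∈))))
        where
        x∉′ : ¬ x ∈ₗ v ∷ w ∷ L
        x∉′ = x∉ ∘ ∈-resp-↭ (↭-sym σ)

ManyMatchings : (Graph n → Set) → ℕ → Set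
ManyMatchings P s = ∃ λ Ms → Unique Ms × (∀ {M} → M ∈ₗ Ms → P M) × s ≤ length Ms

-- For each partner `w` of the first vertex `v`, the edge is joined to matchings of the remaining
-- `s` vertices. Different `w` give different rows at `v`, so the lists for different partners are
-- disjoint.
matchings-on : ∀ s (L : List (Fin n)) → length L ≡ s → Unique L →
               ManyMatchings (MatchingOn L) (matchingCount s)
matchings-on {n} 0 [] _ _ = replicate n ⊥ ∷ [] , [] ∷ [] , empty , s≤s z≤n
  where
  empty : ∀ {M} → M ∈ₗ replicate n ⊥ ∷ [] → MatchingOn [] M
  empty (here refl) = record
    { simple = (λ x y xy → contradiction (subst (y ∈_) (Vec.lookup-replicate x ⊥) xy) Subset.∉⊥)
             , (λ x xx → Subset.∉⊥ (subst (x ∈_) (Vec.lookup-replicate x ⊥) xx))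
    ; one    = λ x ()
    ; none   = λ x _ → Vec.lookup-replicate x ⊥
    }
matchings-on 1 L _ _ = [] , [] , (λ ()) , z≤n
matchings-on {n} (suc (suc s)) (v ∷ L) length-L (v∉L ∷ L!) = finish (through L (λ w∈ → w∈) L!)
  where
  D = matchingCount
  Through : List (Fin n) → Graph n → Set
  Through ws M = MatchingOn (v ∷ L) M × ∃ λ w → w ∈ₗ ws × Adj M v w
  through : ∀ ws → (∀ {w} → w ∈ₗ ws → w ∈ₗ L) → Unique ws →
            ManyMatchings (Through ws) (length ws *ⁿ D s)
  through []       ws⊆L ws!        = [] , [] , (λ ()) , z≤n
  through (w ∷ ws) ws⊆L (w∉ws ∷ ws!) with ∈⇒↭ (ws⊆L (here refl))
  ... | L′ , σ with Unique-resp-↭ σ L!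
  ...   | w∉L′ ∷ L′! with matchings-on s L′ (ℕ.suc-injective (trans (sym (↭-length σ)) (ℕ.suc-injective length-L))) L′!
                        | through ws (ws⊆L ∘ there) ws!
  ...     | Ms , Ms! , onMs , D≤ | Ns , Ns! , onNs , wsD≤ =
    map (join v w) Ms ++ Ns , Unique.++⁺ (map-unique (join v w) Ms! injective) Ns! disjoint , on , enough
    where
    v≢w : v ≢ w
    v≢w = All.lookup v∉L (ws⊆L (here refl))
    v∉L′ : ¬ v ∈ₗ L′
    v∉L′ v∈ = All.lookup v∉L (∈-resp-↭ (↭-sym σ) (there v∈)) refl
    w∉ : ¬ w ∈ₗ L′
    w∉ w∈ = All.lookup w∉L′ w∈ refl
    injective : ∀ {M N} → M ∈ₗ Ms → N ∈ₗ Ms → join v w M ≡ join v w N → M ≡ N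
    injective M∈ N∈ = join-injective v≢w v∉L′ w∉ (onMs M∈) (onMs N∈)
    vw : ∀ M → Adj (join v w M) v w
    vw M = subst (w ∈_) (sym (lookup-join₁ v≢w M)) (Subset.x∈⁅x⁆ w)
    disjoint : ∀ {M} → ¬ (M ∈ₗ map (join v w) Ms × M ∈ₗ Ns)
    disjoint (M∈ , M∈Ns) with ∈-map⁻ (join v w) M∈ | onNs M∈Ns
    ... | M , _ , refl | _ , w′ , w′∈ , vw′ = All.lookup w∉ws w′∈
      (sym (Subset.x∈⁅y⁆⇒x≡y w (subst (w′ ∈_) (lookup-join₁ v≢w M) vw′)))
    on : ∀ {M} → M ∈ₗ map (join v w) Ms ++ Ns → Through (w ∷ ws) M
    on M∈ with ∈-++⁻ (map (join v w) Ms) M∈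
    ... | inj₂ M∈Ns with onNs M∈Ns
    ...   | onM , w′ , w′∈ , vw′ = onM , w′ , there w′∈ , vw′
    on M∈ | inj₁ M∈Ms with ∈-map⁻ (join v w) M∈Ms
    ...   | M , M∈′ , refl = join-on v≢w v∉L′ w∉ (prep v σ) (onMs M∈′) , w , here refl , vw M
    enough : D s + length ws *ⁿ D s ≤ length (map (join v w) Ms ++ Ns)
    enough = ℕ.≤-trans (ℕ.+-mono-≤ D≤ wsD≤) (ℕ.≤-reflexive (sym (trans
      (length-++ (map (join v w) Ms)) (cong (_+ length Ns) (length-map (join v w) Ms)))))
  finish : ManyMatchings (Through L) (length L *ⁿ D s) →
           ManyMatchings (MatchingOn (v ∷ L)) (suc s *ⁿ D s)
  finish (Ms , Ms! , onMs , count) = Ms , Ms! , (proj₁ ∘ onMs) ,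
    subst (λ l → l *ⁿ D s ≤ length Ms) (ℕ.suc-injective length-L) count

_≟ᴳ_ : (G H : Graph n) → Dec (G ≡ H)
_≟ᴳ_ = Vec.≡-dec (Vec.≡-dec Bool._≟_)

-- Turns the upper bounds in terms of `matchingCount n` into bounds relative to all perfect
-- matchings.
matchingCount≤perfectMatchings : ∀ n → matchingCount n ≤ length (perfectMatchings n)
matchingCount≤perfectMatchings n
  with matchings-on n (allFin n) (length-tabulate _) (Unique.allFin⁺ n)
... | Ms , Ms! , onMs , count = ℕ.≤-trans count (unique-⊆⇒length≤ _≟ᴳ_ Ms! λ M∈ →
  ∈-perfectMatchings⁺ (simple (onMs M∈) , λ x → one (onMs M∈) x (∈-allFin x)))

-- Sizes of subsets, and the robber on a graph without balanced cut

-- Connects two ways of counting vertices: filtering a list of them, as in `#`, and counting along a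
-- vector, as in the size of a subset.
length-filter-tabulate : ∀ {a b p q} {A : Set a} {B : Set b} {P : Pred A p} {Q : Pred B q}
  (P? : Decidable P) (Q? : Decidable Q) (f : Fin n → A) (u : Vec B n) →
  (∀ i → P (f i) → Q (lookup u i)) → (∀ i → Q (lookup u i) → P (f i)) →
  length (filter P? (tabulate f)) ≡ count Q? u
length-filter-tabulate P? Q? f []      to from = refl
length-filter-tabulate P? Q? f (x ∷ u) to from with P? (f zero) | Q? x
... | yes _ | yes _ = cong suc (length-filter-tabulate P? Q? (f ∘ suc) u (to ∘ suc) (from ∘ suc))
... | no _  | no _  = length-filter-tabulate P? Q? (f ∘ suc) u (to ∘ suc) (from ∘ suc)
... | yes p | no ¬q = contradiction (to zero p) ¬q
... | no ¬p | yes q = contradiction (from zero q) ¬p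

∣p∪q∣≤∣p∣+∣q∣ : (p q : Subset n) → ∣ p ∪ q ∣ ≤ ∣ p ∣ + ∣ q ∣
∣p∪q∣≤∣p∣+∣q∣ []          []          = z≤n
∣p∪q∣≤∣p∣+∣q∣ (false ∷ p) (false ∷ q) = ∣p∪q∣≤∣p∣+∣q∣ p q
∣p∪q∣≤∣p∣+∣q∣ (true  ∷ p) (false ∷ q) = s≤s (∣p∪q∣≤∣p∣+∣q∣ p q)
∣p∪q∣≤∣p∣+∣q∣ (false ∷ p) (true  ∷ q) =
  ℕ.≤-trans (s≤s (∣p∪q∣≤∣p∣+∣q∣ p q)) (ℕ.≤-reflexive (sym (ℕ.+-suc ∣ p ∣ ∣ q ∣)))
∣p∪q∣≤∣p∣+∣q∣ (true  ∷ p) (true  ∷ q) =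
  s≤s (ℕ.≤-trans (∣p∪q∣≤∣p∣+∣q∣ p q) (ℕ.+-monoʳ-≤ ∣ p ∣ (ℕ.n≤1+n ∣ q ∣)))

module _ {p} {P : Pred (Fin n) p} (P? : Decidable P) where

  comprehension : Subset n
  comprehension = tabulateᵥ (λ x → does (P? x))

  ∈-comprehension⁺ : ∀ {x} → P x → x ∈ comprehension
  ∈-comprehension⁺ {x} px = Vec.lookup⇒[]= x comprehension
    (trans (Vec.lookup∘tabulate (does ∘ P?) x) (dec-true (P? x) px))

  ∈-comprehension⁻ : ∀ {x} → x ∈ comprehension → P x
  ∈-comprehension⁻ {x} x∈ with P? x
    | trans (sym (Vec.lookup∘tabulate (does ∘ P?) x)) (Vec.[]=⇒lookup x∈)
  ... | yes px | _ = px

-- The right side is controlled indirectly: it has more than n/3 - n/102 vertices. The half-open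
-- range for the left side is exactly the gap between "small" and "at least 2n/3".
Balanced : Colouring n → Set
Balanced {n} χ = 102 *ⁿ # χ separator (allFin n) ≤ n
               × n ≤ 3 *ⁿ # χ left (allFin n)
               × 3 *ⁿ # χ left (allFin n) <ⁿ 2 *ⁿ n

∈-update⁻ : ∀ {a} {A : Set a} {x y : A} (c : Vec A k) i → x ∈ᵥ c [ i ]≔ y → x ∈ᵥ c ⊎ x ≡ y
∈-update⁻ (_ ∷ c) zero    (Vec.here eq)  = inj₂ eq
∈-update⁻ (_ ∷ c) zero    (Vec.there x∈) = inj₁ (Vec.there x∈)
∈-update⁻ (_ ∷ c) (suc i) (Vec.here eq)  = inj₁ (Vec.here eq)
∈-update⁻ (_ ∷ c) (suc i) (Vec.there x∈) with ∈-update⁻ c i x∈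
... | inj₁ x∈c = inj₁ (Vec.there x∈c)
... | inj₂ eq  = inj₂ eq

occupied-move⁻ : ∀ {c c′ : Cops n k} {r x} → CopMove r c c′ → Occupied c′ x → Occupied c x ⊎ x ≡ r
occupied-move⁻ stay    o = inj₁ o
occupied-move⁻ {c = c} (fly i) o with ∈-update⁻ c i o
... | inj₁ o′ = inj₁ o′
... | inj₂ eq = inj₂ (Maybe.just-injective eq)

module Game {n : ℕ} (n≥3 : 3 ≤ n) (G : Graph n) (uncut : ∀ χ → Balanced χ → ¬ Separates χ G)
            {k : ℕ} (few : 102 *ⁿ k ≤ n) where

  Closed : Cops n k → Subset n → Set
  Closed c U = ∀ x → x ∈ U → ¬ Occupied c x × (∀ y → Adj G x y → y ∈ U ⊎ Occupied c y)

  closed? : ∀ c → Decidable (Closed c)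
  closed? c U = Fin.all? λ x → (x Subset.∈? U) →-dec (¬? (occupied? c x) ×-dec
    Fin.all? λ y → adj? G x y →-dec ((y Subset.∈? U) ⊎-dec occupied? c y))

  Small : Subset n → Set
  Small U = 3 *ⁿ ∣ U ∣ <ⁿ n

  module _ (c : Cops n k) (U : Subset n) where

    colour : ∀ {x} → Dec (x ∈ U) → Dec (Occupied c x) → Colour
    colour (yes _) _       = left
    colour (no _)  (yes _) = separator
    colour (no _)  (no _)  = right

    boundary : Colouring n
    boundary = tabulateᵥ λ x → colour (x Subset.∈? U) (occupied? c x)

    lookup-boundary : ∀ x → lookup boundary x ≡ colour (x Subset.∈? U) (occupied? c x)
    lookup-boundary = Vec.lookup∘tabulate _

    left⁻ : ∀ x → lookup boundary x ≡ left → x ∈ U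
    left⁻ x eq with x Subset.∈? U | occupied? c x | trans (sym (lookup-boundary x)) eq
    ... | yes x∈ | _     | _ = x∈
    ... | no _   | yes _ | ()
    ... | no _   | no _  | ()

    left⁺ : ∀ x → x ∈ U → lookup boundary x ≡ left
    left⁺ x x∈ with x Subset.∈? U | lookup-boundary x
    ... | yes _ | eq = eq
    ... | no x∉ | _  = contradiction x∈ x∉

    separator⁻ : ∀ x → lookup boundary x ≡ separator → Occupied c x
    separator⁻ x eq with x Subset.∈? U | occupied? c x | trans (sym (lookup-boundary x)) eq
    ... | yes _ | _     | ()
    ... | no _  | yes o | _ = o
    ... | no _  | no _  | ()

    right⁻ : ∀ x → lookup boundary x ≡ right → ¬ x ∈ U × ¬ Occupied c x
    right⁻ x eq with x Subset.∈? U | occupied? c x | trans (sym (lookup-boundary x)) eq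
    ... | yes _ | _     | ()
    ... | no _  | yes _ | ()
    ... | no x∉ | no ¬o | _ = x∉ , ¬o

    #left : # boundary left (allFin n) ≡ ∣ U ∣
    #left = length-filter-tabulate _ _ (λ x → x) U
      (λ x → Vec.[]=⇒lookup ∘ left⁻ x) (λ x → left⁺ x ∘ Vec.lookup⇒[]= x U)

    -- Distinct separator vertices are occupied by distinct cops.
    #separator : # boundary separator (allFin n) ≤ k
    #separator = begin
      length xs            ≡⟨ length-map just xs ⟨
      length (map just xs) ≤⟨ unique-⊆⇒length≤ (Maybe.≡-dec Fin._≟_)
                                (Unique.map⁺ Maybe.just-injective (Unique.filter⁺ sep? (Unique.allFin⁺ n))) occupied ⟩
      length (toList c)    ≡⟨ Vec.length-toList c ⟩
      k                    ∎
      where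
      open ℕ.≤-Reasoning
      sep? = λ x → lookup boundary x ≟ᶜ separator
      xs = coloured boundary separator (allFin n)
      occupied : ∀ {v} → v ∈ₗ map just xs → v ∈ₗ toList c
      occupied v∈ with ∈-map⁻ just v∈
      ... | x , x∈ , refl = ∈ᵥ.∈-toList⁺ (separator⁻ x (proj₂ (∈-filter⁻ sep? {xs = allFin n} x∈)))

    closed⇒separates : Closed c U → Separates boundary G
    closed⇒separates cl x y xy χx χy with proj₂ (cl x (left⁻ x χx)) y xy | right⁻ y χy
    ... | inj₁ y∈ | y∉ , _  = y∉ y∈
    ... | inj₂ o  | _  , ¬o = ¬o o

    -- The gap: a closed set that is not small but below 2n/3 would make `boundary` a balanced
    -- colouring separating `G`, its separator being no larger than the number of cops.
    small : Closed c U → 3 *ⁿ ∣ U ∣ <ⁿ 2 *ⁿ n → Small U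
    small cl lt with 3 *ⁿ ∣ U ∣ ℕ.<? n
    ... | yes s = s
    ... | no ¬s = contradiction (closed⇒separates cl) (uncut boundary
      ( ℕ.≤-trans (ℕ.*-monoʳ-≤ 102 #separator) few
      , subst (λ s → n ≤ 3 *ⁿ s) (sym #left) (ℕ.≮⇒≥ ¬s)
      , subst (λ s → 3 *ⁿ s <ⁿ 2 *ⁿ n) (sym #left) lt))

  ∪-closed : ∀ {c U V} → Closed c U → Closed c V → Closed c (U ∪ V)
  ∪-closed {c} {U} {V} clU clV x x∈ with Subset.x∈p∪q⁻ U V x∈
  ... | inj₁ x∈U = proj₁ (clU x x∈U) , λ y xy → extend (proj₂ (clU x x∈U) y xy)
    where
    extend : ∀ {y} → y ∈ U ⊎ Occupied c y → y ∈ U ∪ V ⊎ Occupied c y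
    extend (inj₁ y∈) = inj₁ (Subset.x∈p∪q⁺ (inj₁ y∈))
    extend (inj₂ o)  = inj₂ o
  ... | inj₂ x∈V = proj₁ (clV x x∈V) , λ y xy → extend (proj₂ (clV x x∈V) y xy)
    where
    extend : ∀ {y} → y ∈ V ⊎ Occupied c y → y ∈ U ∪ V ⊎ Occupied c y
    extend (inj₁ y∈) = inj₁ (Subset.x∈p∪q⁺ (inj₂ y∈))
    extend (inj₂ o)  = inj₂ o

  ∪-small : ∀ {c U V} → Closed c U → Closed c V → Small U → Small V → Small (U ∪ V)
  ∪-small {c} {U} {V} clU clV smU smV = small c (U ∪ V) (∪-closed clU clV) (begin-strict
    3 *ⁿ ∣ U ∪ V ∣               ≤⟨ ℕ.*-monoʳ-≤ 3 (∣p∪q∣≤∣p∣+∣q∣ U V) ⟩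
    3 *ⁿ (∣ U ∣ + ∣ V ∣)         ≡⟨ ℕ.*-distribˡ-+ 3 ∣ U ∣ ∣ V ∣ ⟩
    3 *ⁿ ∣ U ∣ + 3 *ⁿ ∣ V ∣      <⟨ ℕ.+-mono-< smU smV ⟩
    n + n                        ≡⟨ cong (n +_) (ℕ.+-identityʳ n) ⟨
    2 *ⁿ n                       ∎)
    where open ℕ.≤-Reasoning

  GreatestSmall : Cops n k → List (Subset n) → Set
  GreatestSmall c Vs = ∃ λ U → Closed c U × Small U ×
    (∀ {V x} → V ∈ₗ Vs → Closed c V → Small V → x ∈ V → x ∈ U)

  -- The union is built one set at a time, so that `∪-small` can bring it back below n/3 after every
  -- step. With `Vs` all subsets, it contains every small closed set.
  greatest-small : ∀ c Vs → GreatestSmall c Vs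
  greatest-small c [] = ⊥ , (λ x x∈ → contradiction x∈ Subset.∉⊥) ,
    subst (λ s → 3 *ⁿ s <ⁿ n) (sym (Subset.∣⊥∣≡0 n)) (ℕ.≤-trans (s≤s z≤n) n≥3) , λ ()
  greatest-small c (V ∷ Vs) with greatest-small c Vs | closed? c V ×-dec (3 *ⁿ ∣ V ∣ ℕ.<? n)
  ... | U , clU , smU , max | yes (clV , smV) =
    V ∪ U , ∪-closed clV clU , ∪-small clV clU smV smU , λ where
      (here refl) _  _  x∈ → Subset.x∈p∪q⁺ (inj₁ x∈)
      (there W∈)  cl sm x∈ → Subset.x∈p∪q⁺ (inj₂ (max W∈ cl sm x∈))
  ... | U , clU , smU , max | no ¬V = U , clU , smU , λ where
      (here refl) cl sm _  → contradiction (cl , sm) ¬V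
      (there W∈)  cl sm x∈ → max W∈ cl sm x∈

  -- The robber's invariant; it amounts to standing outside the greatest small closed set.
  Safe : Cops n k → Fin n → Set
  Safe c r = ∀ U → Closed c U → Small U → ¬ r ∈ U

  -- If no reply were safe, adding r to the greatest small closed set for the new position
  -- of the cops would give a small closed set for the old one.
  evade : ∀ {c r} → CopsWin G c r → ¬ Occupied c r → ¬ Safe c r
  evade {c} {r} (turn {c′} mv reply) ¬o safe with greatest-small c′ (subsets n)
  ... | U , clU , smU , max =
    safe W closed-W (small c W closed-W size-W) (∈-comprehension⁺ W? (inj₂ refl , ¬o))
    where
    -- A flying cop frees its old vertex, which may belong to `U`. `W` omits that vertex, and in the
    -- old position `c` the cop still blocks it.
    W? : Decidable (λ x → (x ∈ U ⊎ x ≡ r) × ¬ Occupied c x)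
    W? x = ((x Subset.∈? U) ⊎-dec (x Fin.≟ r)) ×-dec ¬? (occupied? c x)
    W = comprehension W?
    trapped : ∀ y → Adj G r y → y ∈ U ⊎ Occupied c′ y
    trapped y ry with y Subset.∈? U | occupied? c′ y
    ... | yes y∈ | _      = inj₁ y∈
    ... | no _   | yes o  = inj₂ o
    -- A legal reply outside `U` would be safe because `U` contains all small closed sets; the
    -- induction along the cops' strategy excludes a safe reply.
    ... | no y∉  | no ¬o′ = contradiction
      (λ V clV smV y∈ → y∉ (max (∈-subsets V) clV smV y∈)) (evade (reply y ry ¬o′) ¬o′)
    exits : ∀ {x} → x ∈ U ⊎ x ≡ r → ∀ y → Adj G x y → y ∈ U ⊎ Occupied c′ y
    exits (inj₁ x∈)   = proj₂ (clU _ x∈)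
    exits (inj₂ refl) = trapped
    stays : ∀ {y} → y ∈ U ⊎ Occupied c′ y → y ∈ W ⊎ Occupied c y
    stays {y} e with occupied? c y
    stays     e         | yes o  = inj₂ o
    stays     (inj₁ y∈) | no ¬o = inj₁ (∈-comprehension⁺ W? (inj₁ y∈ , ¬o))
    stays     (inj₂ o′) | no ¬o with occupied-move⁻ mv o′
    ... | inj₁ o  = contradiction o ¬o
    ... | inj₂ eq = inj₁ (∈-comprehension⁺ W? (inj₂ eq , ¬o))
    closed-W : Closed c W
    closed-W x x∈ with ∈-comprehension⁻ W? x∈
    ... | x∈U+r , ¬ox = ¬ox , λ y xy → stays (exits x∈U+r y xy)
    W⊆ : ∀ {x} → x ∈ W → x ∈ U ∪ ⁅ r ⁆
    W⊆ x∈ with ∈-comprehension⁻ W? x∈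
    ... | inj₁ x∈U  , _ = Subset.x∈p∪q⁺ (inj₁ x∈U)
    ... | inj₂ refl , _ = Subset.x∈p∪q⁺ (inj₂ (Subset.x∈⁅x⁆ r))
    -- The vertex `r` adds 3 to `3 * ∣ U ∣`, which is affordable since `n` is at least 3; the gap
    -- then makes `W` small.
    size-W : 3 *ⁿ ∣ W ∣ <ⁿ 2 *ⁿ n
    size-W = begin-strict
      3 *ⁿ ∣ W ∣                       ≤⟨ ℕ.*-monoʳ-≤ 3 (Subset.p⊆q⇒∣p∣≤∣q∣ W⊆) ⟩
      3 *ⁿ ∣ U ∪ ⁅ r ⁆ ∣               ≤⟨ ℕ.*-monoʳ-≤ 3 (∣p∪q∣≤∣p∣+∣q∣ U ⁅ r ⁆) ⟩
      3 *ⁿ (∣ U ∣ + ∣ ⁅ r ⁆ ∣)         ≡⟨ cong (λ s → 3 *ⁿ (∣ U ∣ + s)) (Subset.∣⁅x⁆∣≡1 r) ⟩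
      3 *ⁿ (∣ U ∣ + 1)                 ≡⟨ ℕ.*-distribˡ-+ 3 ∣ U ∣ 1 ⟩
      3 *ⁿ ∣ U ∣ + 3                   <⟨ ℕ.+-mono-<-≤ smU n≥3 ⟩
      n + n                            ≡⟨ cong (n +_) (ℕ.+-identityʳ n) ⟨
      2 *ⁿ n                           ∎
      where open ℕ.≤-Reasoning

  -- A small set is not the whole vertex set, so before any cop is placed there is a vertex outside
  -- the greatest one: the robber's starting point.
  ¬canCatch : ¬ CanCatch k G
  ¬canCatch catch with greatest-small (replicate k nothing) (subsets n)
  ... | U , clU , smU , max with Fin.any? (λ r → ¬? (r Subset.∈? U))
  ... | yes (r , r∉) = evade (catch r) (unoccupied k)
          (λ V clV smV r∈ → r∉ (max (∈-subsets V) clV smV r∈))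
    where
    unoccupied : ∀ k {v : Fin n} → ¬ Occupied (replicate k nothing) v
    unoccupied (suc k) (Vec.there o) = unoccupied k o
  ... | no all = ℕ.<⇒≱ smU (ℕ.≤-trans n≤∣U∣ (ℕ.m≤n*m ∣ U ∣ 3))
    where
    full : ∀ r → r ∈ U
    full r with r Subset.∈? U
    ... | yes r∈ = r∈
    ... | no r∉  = contradiction (r , r∉) all
    n≤∣U∣ : n ≤ ∣ U ∣
    n≤∣U∣ = ℕ.≤-trans (ℕ.≤-reflexive (sym (Subset.∣⊤∣≡n n))) (Subset.p⊆q⇒∣p∣≤∣q∣ {p = ⊤} (λ {x} _ → full x))

-- Chernoff bound for the number of balanced colourings: a colouring with few separator
-- vertices has large weight, whereas the total weight is (1 + 20 + 20)ⁿ.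

weight : Colouring n → ℕ
weight []              = 1
weight (separator ∷ χ) = weight χ
weight (left      ∷ χ) = 20 *ⁿ weight χ
weight (right     ∷ χ) = 20 *ⁿ weight χ

totalWeight : List (Colouring n) → ℕ
totalWeight []       = 0
totalWeight (χ ∷ χs) = weight χ + totalWeight χs

colours : List Colour
colours = separator ∷ left ∷ right ∷ []

∈-colours : ∀ k → k ∈ₗ colours
∈-colours separator = here refl
∈-colours left      = there (here refl)
∈-colours right     = there (there (here refl))

totalWeight-++ : (χs ψs : List (Colouring n)) →
                 totalWeight (χs ++ ψs) ≡ totalWeight χs + totalWeight ψs
totalWeight-++ []       ψs = refl
totalWeight-++ (χ ∷ χs) ψs = trans (cong (weight χ +_) (totalWeight-++ χs ψs))
  (sym (ℕ.+-assoc (weight χ) (totalWeight χs) (totalWeight ψs)))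

totalWeight-map : ∀ w k → (∀ (χ : Colouring n) → weight (k ∷ χ) ≡ w *ⁿ weight χ) →
                  (χs : List (Colouring n)) → totalWeight (map (k ∷_) χs) ≡ w *ⁿ totalWeight χs
totalWeight-map w k eq []       = sym (ℕ.*-zeroʳ w)
totalWeight-map w k eq (χ ∷ χs) = trans (cong₂ _+_ (eq χ) (totalWeight-map w k eq χs))
  (sym (ℕ.*-distribˡ-+ w (weight χ) (totalWeight χs)))

totalWeight-vectors : ∀ n → totalWeight (vectors colours n) ≡ 41 ^ n
totalWeight-vectors zero    = refl
totalWeight-vectors (suc n) = begin
  totalWeight (map (separator ∷_) χs ++ (map (left ∷_) χs ++ (map (right ∷_) χs ++ [])))
    ≡⟨ totalWeight-++ (map (separator ∷_) χs) _ ⟩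
  totalWeight (map (separator ∷_) χs) + totalWeight (map (left ∷_) χs ++ (map (right ∷_) χs ++ []))
    ≡⟨ cong₂ _+_ (totalWeight-map 1 separator (λ χ → sym (ℕ.*-identityˡ _)) χs)
         (totalWeight-++ (map (left ∷_) χs) _) ⟩
  1 *ⁿ W + (totalWeight (map (left ∷_) χs) + totalWeight (map (right ∷_) χs ++ []))
    ≡⟨ cong (1 *ⁿ W +_) (cong₂ _+_ (totalWeight-map 20 left (λ _ → refl) χs)
         (trans (totalWeight-++ (map (right ∷_) χs) [])
           (cong (_+ 0) (totalWeight-map 20 right (λ _ → refl) χs)))) ⟩
  1 *ⁿ W + (20 *ⁿ W + (20 *ⁿ W + 0))
    ≡⟨ solve 1 (λ w → con 1 :* w :+ (con 20 :* w :+ (con 20 :* w :+ con 0)) := con 41 :* w) refl W ⟩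
  41 *ⁿ W
    ≡⟨ cong (41 *ⁿ_) (totalWeight-vectors n) ⟩
  41 ^ suc n ∎
  where
  open ≡-Reasoning
  open +-*-Solver
  χs = vectors colours n
  W = totalWeight χs

separators : Colouring n → ℕ
separators = count (_≟ᶜ separator)

-- Says that the weight is 20 to the power n minus the number of separators, without subtracting
-- exponents.
weight-separators : (χ : Colouring n) → 20 ^ n ≡ weight χ *ⁿ 20 ^ separators χ
weight-separators []              = refl
weight-separators {suc n} (separator ∷ χ) = begin
  20 *ⁿ 20 ^ n                            ≡⟨ cong (20 *ⁿ_) (weight-separators χ) ⟩
  20 *ⁿ (weight χ *ⁿ 20 ^ separators χ)   ≡⟨ x∙yz≈y∙xz ℕ.*-commutativeSemigroup 20 (weight χ) (20 ^ separators χ) ⟩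
  weight χ *ⁿ (20 *ⁿ 20 ^ separators χ)   ∎
  where
  open ≡-Reasoning
weight-separators (left ∷ χ)  = trans (cong (20 *ⁿ_) (weight-separators χ)) (sym (ℕ.*-assoc 20 (weight χ) _))
weight-separators (right ∷ χ) = trans (cong (20 *ⁿ_) (weight-separators χ)) (sym (ℕ.*-assoc 20 (weight χ) _))

-- Markov's inequality for `weight` with threshold `a / b`, cleared of denominators.
markov : ∀ {p} {P : Pred (Colouring n) p} (P? : Decidable P) a b →
         (∀ χ → P χ → a ≤ weight χ *ⁿ b) →
         ∀ χs → length (filter P? χs) *ⁿ a ≤ totalWeight χs *ⁿ b
markov P? a b le []       = z≤n
markov P? a b le (χ ∷ χs) with P? χ
... | yes p = ℕ.≤-trans (ℕ.+-mono-≤ (le χ p) (markov P? a b le χs))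
                (ℕ.≤-reflexive (sym (ℕ.*-distribʳ-+ b (weight χ) (totalWeight χs))))
... | no _  = ℕ.≤-trans (markov P? a b le χs) (ℕ.*-monoˡ-≤ b (ℕ.m≤n+m (totalWeight χs) (weight χ)))

balanced? : Decidable (Balanced {n})
balanced? {n} χ = (102 *ⁿ # χ separator (allFin n) ℕ.≤? n)
            ×-dec (n ℕ.≤? 3 *ⁿ # χ left (allFin n))
            ×-dec (3 *ⁿ # χ left (allFin n) ℕ.<? 2 *ⁿ n)

balancedColourings : ∀ n → List (Colouring n)
balancedColourings n = filter balanced? (vectors colours n)

#separator≡separators : (χ : Colouring n) → # χ separator (allFin n) ≡ separators χ
#separator≡separators χ =
  length-filter-tabulate _ (_≟ᶜ separator) (λ x → x) χ (λ _ eq → eq) (λ _ eq → eq)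

-- The hypothesis says that `t` is at least ⌊n/102⌋, so a balanced colouring has weight at least 20
-- to the power n - t.
length-balancedColourings : ∀ n t → (∀ c → 102 *ⁿ c ≤ n → c ≤ t) →
                            length (balancedColourings n) *ⁿ 20 ^ n ≤ 41 ^ n *ⁿ 20 ^ t
length-balancedColourings n t c≤t = ℕ.≤-trans
  (markov balanced? (20 ^ n) (20 ^ t) heavy (vectors colours n))
  (ℕ.≤-reflexive (cong (_*ⁿ 20 ^ t) (totalWeight-vectors n)))
  where
  heavy : (χ : Colouring n) → Balanced χ → 20 ^ n ≤ weight χ *ⁿ 20 ^ t
  heavy χ (few , _) = ℕ.≤-trans (ℕ.≤-reflexive (weight-separators χ))
    (ℕ.*-monoʳ-≤ (weight χ) (ℕ.^-monoʳ-≤ 20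
      (c≤t (separators χ) (subst (λ c → 102 *ⁿ c ≤ n) (#separator≡separators χ) few))))

-- The union bound over colourings for triples of matchings

length-filter-map : ∀ {b c p q} {B : Set b} {C : Set c} {P : Pred C p} {Q : Pred B q}
                    (P? : Decidable P) (Q? : Decidable Q) (f : B → C) →
                    (∀ {y} → P (f y) → Q y) → ∀ ys →
                    length (filter P? (map f ys)) ≤ length (filter Q? ys)
length-filter-map P? Q? f P⇒Q []       = z≤n
length-filter-map P? Q? f P⇒Q (y ∷ ys) with P? (f y) | Q? y
... | yes _ | yes _ = s≤s (length-filter-map P? Q? f P⇒Q ys)
... | yes p | no ¬q = contradiction (P⇒Q p) ¬q
... | no _  | yes _ = ℕ.m≤n⇒m≤1+n (length-filter-map P? Q? f P⇒Q ys)
... | no _  | no _  = length-filter-map P? Q? f P⇒Q ys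

length-filter-map-none : ∀ {b c p} {B : Set b} {C : Set c} {P : Pred C p} (P? : Decidable P) →
                         ∀ (f : B → C) → (∀ {y} → ¬ P (f y)) → ∀ ys →
                         length (filter P? (map f ys)) ≡ 0
length-filter-map-none P? f none []       = refl
length-filter-map-none P? f none (y ∷ ys) with P? (f y)
... | yes p = contradiction p none
... | no _  = length-filter-map-none P? f none ys

-- Independence in counting form: an event implying a condition on each coordinate is bounded by the
-- product of the two counts.
length-filter-product : ∀ {a b p q r} {A : Set a} {B : Set b}
  {P : Pred (A × B) p} {Q : Pred A q} {R : Pred B r}
  (P? : Decidable P) (Q? : Decidable Q) (R? : Decidable R) →
  (∀ {x y} → P (x , y) → Q x × R y) → ∀ xs ys →
  length (filter P? (cartesianProduct xs ys)) ≤ length (filter Q? xs) *ⁿ length (filter R? ys)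
length-filter-product P? Q? R? P⇒ []       ys = z≤n
length-filter-product P? Q? R? P⇒ (x ∷ xs) ys = begin
  length (filter P? (cartesianProduct (x ∷ xs) ys))
    ≡⟨ cong length (filter-++ P? (map (x ,_) ys) (cartesianProduct xs ys)) ⟩
  length (filter P? (map (x ,_) ys) ++ filter P? (cartesianProduct xs ys))
    ≡⟨ length-++ (filter P? (map (x ,_) ys)) ⟩
  length (filter P? (map (x ,_) ys)) + length (filter P? (cartesianProduct xs ys))
    ≤⟨ ℕ.+-monoʳ-≤ (length (filter P? (map (x ,_) ys))) (length-filter-product P? Q? R? P⇒ xs ys) ⟩
  length (filter P? (map (x ,_) ys)) + length (filter Q? xs) *ⁿ length (filter R? ys)
    ≤⟨ head ⟩
  length (filter Q? (x ∷ xs)) *ⁿ length (filter R? ys) ∎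
  where
  open ℕ.≤-Reasoning
  head : length (filter P? (map (x ,_) ys)) + length (filter Q? xs) *ⁿ length (filter R? ys) ≤
         length (filter Q? (x ∷ xs)) *ⁿ length (filter R? ys)
  head with Q? x
  ... | yes _ = ℕ.+-monoˡ-≤ _ (length-filter-map P? R? (x ,_) (proj₂ ∘ P⇒) ys)
  ... | no ¬q = ℕ.≤-reflexive
    (cong (_+ length (filter Q? xs) *ⁿ length (filter R? ys)) (length-filter-map-none P? (x ,_) (λ p → ¬q (proj₁ (P⇒ p))) ys))

length-cartesianProduct : ∀ {a b} {A : Set a} {B : Set b} (xs : List A) (ys : List B) →
                          length (cartesianProduct xs ys) ≡ length xs *ⁿ length ys
length-cartesianProduct []       ys = refl
length-cartesianProduct (x ∷ xs) ys = trans (length-++ (map (x ,_) ys))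
  (cong₂ _+_ (length-map (x ,_) ys) (length-cartesianProduct xs ys))

cube : ℕ → ℕ
cube x = x *ⁿ (x *ⁿ x)

cube-mono : ∀ {x y} → x ≤ y → cube x ≤ cube y
cube-mono le = ℕ.*-mono-≤ le (ℕ.*-mono-≤ le le)

cube-* : ∀ x y → cube (x *ⁿ y) ≡ cube x *ⁿ cube y
cube-* = solve 2 (λ x y → x :* y :* (x :* y :* (x :* y)) := x :* (x :* x) :* (y :* (y :* y))) refl
  where open +-*-Solver

length-matchingTriples : ∀ n → length (matchingTriples n) ≡ cube (length (perfectMatchings n))
length-matchingTriples n = trans (length-cartesianProduct (perfectMatchings n) _)
  (cong (length (perfectMatchings n) *ⁿ_) (length-cartesianProduct (perfectMatchings n) _))

Cut : Graph n × Graph n × Graph n → Set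
Cut {n} Ms = Any (λ χ → Separates χ (unionOf Ms)) (balancedColourings n)

cut? : Decidable (Cut {n})
cut? Ms = any? (λ χ → separates? χ (unionOf Ms)) _

separates-∪ᴳ : ∀ (χ : Colouring n) G H → Separates χ (G ∪ᴳ H) → Separates χ G × Separates χ H
separates-∪ᴳ χ G H sep =
  (λ x y xy → sep x y (Adj-∪ᴳ⁺ G H x y (inj₁ xy))) ,
  (λ x y xy → sep x y (Adj-∪ᴳ⁺ G H x y (inj₂ xy)))

separated : Colouring n → List (Graph n)
separated {n} χ = filter (separates? χ) (perfectMatchings n)

separated-family : (χ : Colouring n) → Family χ (allFin n) (separated χ)
separated-family {n} χ = record
  { unique   = Unique.filter⁺ (separates? χ) (perfectMatchings-unique n)
  ; perfect  = λ M∈ → ∈-perfectMatchings⁻ (proj₁ (∈-filter⁻ (separates? χ) {xs = perfectMatchings n} M∈))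
  ; separate = λ M∈ → proj₂ (∈-filter⁻ (separates? χ) {xs = perfectMatchings n} M∈)
  ; closed   = λ _ _ _ → ∈-allFin _
  ; agree    = λ {M} {N} {x} _ _ x∉ → contradiction (∈-allFin x) x∉
  }

-- The two hypotheses pin `t` to ⌊n/102⌋. The number 16 is dictated by the right side, see `qb`.
length-separated : (χ : Colouring n) → Balanced χ → ∀ t → 102 *ⁿ t ≤ n →
                   (∀ c → 102 *ⁿ c ≤ n → c ≤ t) →
                   length (separated χ) *ⁿ 5 ^ (16 *ⁿ t) ≤ length (perfectMatchings n)
length-separated {n} χ (few , n≤3a , 3a<2n) t t≤ c≤t = begin
  length (separated χ) *ⁿ 5 ^ (16 *ⁿ t)
    ≤⟨ count-separating χ (16 *ⁿ t) c a b refl refl refl qa qb qab (Unique.allFin⁺ n) (separated-family χ) ⟩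
  matchingCount (c + (a + b)) ≡⟨ cong matchingCount total ⟩
  matchingCount n             ≤⟨ matchingCount≤perfectMatchings n ⟩
  length (perfectMatchings n) ∎
  where
  open ℕ.≤-Reasoning
  open +-*-Solver
  a = # χ left (allFin n)
  b = # χ right (allFin n)
  c = # χ separator (allFin n)
  total : c + (a + b) ≡ n
  total = trans (#-total χ (allFin n)) (length-tabulate (λ x → x))
  small : c ≤ t
  small = c≤t c few
  qa : 2 *ⁿ (16 *ⁿ t) + c ≤ a
  qa = ℕ.*-cancelˡ-≤ 3 (begin
    3 *ⁿ (2 *ⁿ (16 *ⁿ t) + c)  ≤⟨ ℕ.*-monoʳ-≤ 3 (ℕ.+-monoʳ-≤ (2 *ⁿ (16 *ⁿ t)) small) ⟩
    3 *ⁿ (2 *ⁿ (16 *ⁿ t) + t)  ≡⟨ solve 1 (λ t → con 3 :* (con 2 :* (con 16 :* t) :+ t) := con 99 :* t) refl t ⟩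
    99 *ⁿ t                    ≤⟨ ℕ.*-monoˡ-≤ t (ℕ.m≤m+n 99 3) ⟩
    102 *ⁿ t                   ≤⟨ t≤ ⟩
    n                          ≤⟨ n≤3a ⟩
    3 *ⁿ a                     ∎)
  -- The separator is charged twice, once because it is missing from the right side and once as the
  -- budget `c`. With `c ≤ t` this makes 96t + 6t = 102t, leaving no room in `102 * t ≤ n`.
  qb : 2 *ⁿ (16 *ⁿ t) + c ≤ b
  qb = ℕ.*-cancelˡ-≤ 3 (ℕ.+-cancelʳ-≤ (3 *ⁿ c + 3 *ⁿ a) _ _ (begin
    3 *ⁿ (2 *ⁿ (16 *ⁿ t) + c) + (3 *ⁿ c + 3 *ⁿ a)
      ≡⟨ solve 3 (λ t c a → con 3 :* (con 2 :* (con 16 :* t) :+ c) :+ (con 3 :* c :+ con 3 :* a)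
                   := (con 96 :* t :+ con 6 :* c) :+ con 3 :* a) refl t c a ⟩
    96 *ⁿ t + 6 *ⁿ c + 3 *ⁿ a
      ≤⟨ ℕ.+-mono-≤ (ℕ.+-monoʳ-≤ (96 *ⁿ t) (ℕ.*-monoʳ-≤ 6 small)) (ℕ.<⇒≤ 3a<2n) ⟩
    96 *ⁿ t + 6 *ⁿ t + 2 *ⁿ n
      ≡⟨ cong (_+ 2 *ⁿ n) (ℕ.*-distribʳ-+ t 96 6) ⟨
    102 *ⁿ t + 2 *ⁿ n
      ≤⟨ ℕ.+-monoˡ-≤ (2 *ⁿ n) t≤ ⟩
    3 *ⁿ n
      ≡⟨ cong (3 *ⁿ_) total ⟨
    3 *ⁿ (c + (a + b))
      ≡⟨ solve 3 (λ c a b → con 3 :* (c :+ (a :+ b)) := con 3 :* b :+ (con 3 :* c :+ con 3 :* a)) refl c a b ⟩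
    3 *ⁿ b + (3 *ⁿ c + 3 *ⁿ a) ∎))
  qab : 6 *ⁿ (16 *ⁿ t) + c ≤ a + b
  qab = ℕ.+-cancelˡ-≤ c _ _ (begin
    c + (6 *ⁿ (16 *ⁿ t) + c)  ≤⟨ ℕ.+-mono-≤ small (ℕ.+-monoʳ-≤ (6 *ⁿ (16 *ⁿ t)) small) ⟩
    t + (6 *ⁿ (16 *ⁿ t) + t)  ≡⟨ solve 1 (λ t → t :+ (con 6 :* (con 16 :* t) :+ t) := con 98 :* t) refl t ⟩
    98 *ⁿ t                   ≤⟨ ℕ.*-monoˡ-≤ t (ℕ.m≤m+n 98 4) ⟩
    102 *ⁿ t                  ≤⟨ t≤ ⟩
    n                         ≡⟨ total ⟨
    c + (a + b)               ∎)

cutTriples : ∀ n → List (Graph n × Graph n × Graph n)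
cutTriples n = filter cut? (matchingTriples n)

-- A colouring separating the union separates each of the three matchings, so every colouring
-- accounts for at most the cube of its number of separated matchings.
union-bound : ∀ n t → 102 *ⁿ t ≤ n → (∀ c → 102 *ⁿ c ≤ n → c ≤ t) →
              length (cutTriples n) *ⁿ cube (5 ^ (16 *ⁿ t)) ≤
              length (balancedColourings n) *ⁿ length (matchingTriples n)
union-bound n t t≤ c≤t = length-cover sep? (cube z) (length (matchingTriples n))
  (balancedColourings n) (cutTriples n) cover piece
  where
  open ℕ.≤-Reasoning
  z = 5 ^ (16 *ⁿ t)
  Ms = perfectMatchings n
  sep? : (χ : Colouring n) → Decidable (λ Ms → Separates χ (unionOf Ms))
  sep? χ Ms = separates? χ (unionOf Ms)
  cover : ∀ {Ms} → Ms ∈ₗ cutTriples n → ∃ λ χ → χ ∈ₗ balancedColourings n × Separates χ (unionOf Ms)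
  cover Ms∈ = find (proj₂ (∈-filter⁻ cut? {xs = matchingTriples n} Ms∈))
  pair? : (χ : Colouring n) → Decidable (λ ((M , N) : Graph n × Graph n) → Separates χ M × Separates χ N)
  pair? χ (M , N) = separates? χ M ×-dec separates? χ N
  separate₃ : ∀ χ ((M₁ , M₂ , M₃) : Graph n × Graph n × Graph n) → Separates χ (unionOf (M₁ , M₂ , M₃)) →
              Separates χ M₁ × Separates χ M₂ × Separates χ M₃
  separate₃ χ (M₁ , M₂ , M₃) sep with separates-∪ᴳ χ (M₁ ∪ᴳ M₂) M₃ sep
  ... | sep₁₂ , sep₃ with separates-∪ᴳ χ M₁ M₂ sep₁₂
  ...   | sep₁ , sep₂ = sep₁ , sep₂ , sep₃
  piece : ∀ {χ} → χ ∈ₗ balancedColourings n →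
          length (filter (sep? χ) (cutTriples n)) *ⁿ cube z ≤ length (matchingTriples n)
  piece {χ} χ∈ = begin
    length (filter (sep? χ) (cutTriples n)) *ⁿ cube z
      ≤⟨ ℕ.*-monoˡ-≤ (cube z) (length-filter-filter (sep? χ) cut? (matchingTriples n)) ⟩
    length (filter (sep? χ) (matchingTriples n)) *ⁿ cube z
      ≤⟨ ℕ.*-monoˡ-≤ (cube z) (ℕ.≤-trans
           (length-filter-product (sep? χ) (separates? χ) (pair? χ) (λ {M} {Ns} → separate₃ χ (M , Ns)) Ms (cartesianProduct Ms Ms))
           (ℕ.*-monoʳ-≤ (length (separated χ))
             (length-filter-product (pair? χ) (separates? χ) (separates? χ) (λ s → s) Ms Ms))) ⟩
    cube (length (separated χ)) *ⁿ cube z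
      ≡⟨ cube-* (length (separated χ)) z ⟨
    cube (length (separated χ) *ⁿ z)
      ≤⟨ cube-mono (length-separated χ (proj₂ (∈-filter⁻ balanced? {xs = vectors colours n} χ∈)) t t≤ c≤t) ⟩
    cube (length Ms)
      ≡⟨ length-matchingTriples n ⟨
    length (matchingTriples n) ∎

-- Numerical estimates

^-distribʳ-* : ∀ k a b → (a *ⁿ b) ^ k ≡ a ^ k *ⁿ b ^ k
^-distribʳ-* zero    a b = refl
^-distribʳ-* (suc k) a b = trans (cong (a *ⁿ b *ⁿ_) (^-distribʳ-* k a b))
  (solve 4 (λ a b x y → a :* b :* (x :* y) := a :* x :* (b :* y)) refl a b (a ^ k) (b ^ k))
  where open +-*-Solver

^-vertices : ∀ a r t → a ^ (2 *ⁿ (r + t *ⁿ 51)) ≡ (a ^ 2) ^ r *ⁿ (a ^ 102) ^ t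
^-vertices a r t = begin
  a ^ (2 *ⁿ (r + t *ⁿ 51))   ≡⟨ cong (a ^_) (solve 2 (λ r t →
                                  con 2 :* (r :+ t :* con 51) := con 2 :* r :+ con 102 :* t) refl r t) ⟩
  a ^ (2 *ⁿ r + 102 *ⁿ t)    ≡⟨ ℕ.^-distribˡ-+-* a (2 *ⁿ r) (102 *ⁿ t) ⟩
  a ^ (2 *ⁿ r) *ⁿ a ^ (102 *ⁿ t) ≡⟨ cong₂ _*ⁿ_ (ℕ.^-*-assoc a 2 r) (ℕ.^-*-assoc a 102 t) ⟨
  (a ^ 2) ^ r *ⁿ (a ^ 102) ^ t ∎
  where
  open ≡-Reasoning
  open +-*-Solver

cube-power : ∀ e t → cube (e ^ (16 *ⁿ t)) ≡ (e ^ 48) ^ t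
cube-power e t = begin
  cube (e ^ (16 *ⁿ t)) ≡⟨ cong (e ^ (16 *ⁿ t) *ⁿ_) (ℕ.^-distribˡ-+-* e (16 *ⁿ t) (16 *ⁿ t)) ⟨
  e ^ (16 *ⁿ t) *ⁿ e ^ (16 *ⁿ t + 16 *ⁿ t) ≡⟨ ℕ.^-distribˡ-+-* e (16 *ⁿ t) (16 *ⁿ t + 16 *ⁿ t) ⟨
  e ^ (16 *ⁿ t + (16 *ⁿ t + 16 *ⁿ t)) ≡⟨ cong (e ^_) (solve 1 (λ t →
      con 16 :* t :+ (con 16 :* t :+ con 16 :* t) := con 48 :* t) refl t) ⟩
  e ^ (48 *ⁿ t) ≡⟨ ℕ.^-*-assoc e 48 t ⟨
  (e ^ 48) ^ t ∎
  where
  open ≡-Reasoning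
  open +-*-Solver

-- The vertices are grouped into `t` blocks of 102 and `r` leftover pairs. A block satisfies the
-- second inequality with no loss; each pair may lose a factor `d`, at most `d ^ 50` in all. In the
-- application `c` combines the 20 of the weights with the 2 of the decay.
power-bound : ∀ a b c d e → .{{NonZero d}} → a ^ 2 ≤ d *ⁿ b ^ 2 → a ^ 102 *ⁿ c ≤ e ^ 48 *ⁿ b ^ 102 →
  ∃ λ B → ∀ r t → r ≤ 50 →
    a ^ (2 *ⁿ (r + t *ⁿ 51)) *ⁿ c ^ t ≤ B *ⁿ (cube (e ^ (16 *ⁿ t)) *ⁿ b ^ (2 *ⁿ (r + t *ⁿ 51)))
power-bound a b c d e a²≤ a¹⁰²c≤ = d ^ 50 , λ r t r≤50 → begin
  a ^ (2 *ⁿ (r + t *ⁿ 51)) *ⁿ c ^ t          ≡⟨ cong (_*ⁿ c ^ t) (^-vertices a r t) ⟩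
  (a ^ 2) ^ r *ⁿ (a ^ 102) ^ t *ⁿ c ^ t      ≡⟨ ℕ.*-assoc ((a ^ 2) ^ r) ((a ^ 102) ^ t) (c ^ t) ⟩
  (a ^ 2) ^ r *ⁿ ((a ^ 102) ^ t *ⁿ c ^ t)    ≡⟨ cong ((a ^ 2) ^ r *ⁿ_) (^-distribʳ-* t (a ^ 102) c) ⟨
  (a ^ 2) ^ r *ⁿ (a ^ 102 *ⁿ c) ^ t          ≤⟨ ℕ.*-mono-≤ (ℕ.^-monoˡ-≤ r a²≤) (ℕ.^-monoˡ-≤ t a¹⁰²c≤) ⟩
  (d *ⁿ b ^ 2) ^ r *ⁿ (e ^ 48 *ⁿ b ^ 102) ^ t
    ≡⟨ cong₂ _*ⁿ_ (^-distribʳ-* r d (b ^ 2)) (^-distribʳ-* t (e ^ 48) (b ^ 102)) ⟩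
  d ^ r *ⁿ (b ^ 2) ^ r *ⁿ ((e ^ 48) ^ t *ⁿ (b ^ 102) ^ t)
    ≡⟨ rearrange (d ^ r) ((b ^ 2) ^ r) ((e ^ 48) ^ t) ((b ^ 102) ^ t) ⟩
  d ^ r *ⁿ ((e ^ 48) ^ t *ⁿ ((b ^ 2) ^ r *ⁿ (b ^ 102) ^ t))
    ≤⟨ ℕ.*-monoˡ-≤ _ (ℕ.^-monoʳ-≤ d r≤50) ⟩
  d ^ 50 *ⁿ ((e ^ 48) ^ t *ⁿ ((b ^ 2) ^ r *ⁿ (b ^ 102) ^ t))
    ≡⟨ cong (d ^ 50 *ⁿ_) (cong₂ _*ⁿ_ (cube-power e t) (^-vertices b r t)) ⟨
  d ^ 50 *ⁿ (cube (e ^ (16 *ⁿ t)) *ⁿ b ^ (2 *ⁿ (r + t *ⁿ 51))) ∎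
  where
  open ℕ.≤-Reasoning
  open +-*-Solver
  rearrange : ∀ x u y v → x *ⁿ u *ⁿ (y *ⁿ v) ≡ x *ⁿ (y *ⁿ (u *ⁿ v))
  rearrange = solve 4 (λ x u y v → x :* u :* (y :* v) := x :* (y :* (u :* v))) refl

-- Abstract, because the constant 9⁵⁰ must not be unfolded to unary.  Here n = 2 (r + 51 t), the
-- separator has at most t vertices, and the choice of 51, 20 and 16 is what makes
-- 2 · 20 · 41¹⁰² ≤ 5⁴⁸ · 20¹⁰² true.

abstract
  numeric-bound : ∃ λ B → ∀ r t → r ≤ 50 →
    41 ^ (2 *ⁿ (r + t *ⁿ 51)) *ⁿ (20 *ⁿ 2) ^ t ≤
    B *ⁿ (cube (5 ^ (16 *ⁿ t)) *ⁿ 20 ^ (2 *ⁿ (r + t *ⁿ 51)))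
  numeric-bound = power-bound 41 20 (20 *ⁿ 2) 9 5
    -- 1681 ≤ 3600. The value 9 is generous; it affects only the constant `B`.
    (ℕ.≤ᵇ⇒≤ (41 ^ 2) (9 *ⁿ 20 ^ 2) _)
    (ℕ.≤ᵇ⇒≤ (41 ^ 102 *ⁿ (20 *ⁿ 2)) (5 ^ 48 *ⁿ 20 ^ 102) _)

constant : ℕ
constant = proj₁ numeric-bound

-- Multiplies the union bound, the count of colourings and the numerical bound, then cancels
-- `z * y`. Here `x` counts the cut triples, `a` all triples, `c` the colourings, and `p` is the
-- decay.
chain-bounds : ∀ x y z p a c u v B → .{{NonZero (z *ⁿ y)}} →
               x *ⁿ z ≤ c *ⁿ a → c *ⁿ y ≤ u *ⁿ v → u *ⁿ (v *ⁿ p) ≤ B *ⁿ (z *ⁿ y) →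
               x *ⁿ p ≤ B *ⁿ a
chain-bounds x y z p a c u v B xz≤ca cy≤uv uvp≤ = ℕ.*-cancelʳ-≤ _ _ (z *ⁿ y) (begin
  x *ⁿ p *ⁿ (z *ⁿ y)     ≡⟨ solve 4 (λ a b c d → a :* b :* (c :* d) := a :* c :* (d :* b)) refl x p z y ⟩
  x *ⁿ z *ⁿ (y *ⁿ p)     ≤⟨ ℕ.*-monoˡ-≤ (y *ⁿ p) xz≤ca ⟩
  c *ⁿ a *ⁿ (y *ⁿ p)     ≡⟨ solve 4 (λ a b c d → a :* b :* (c :* d) := a :* c :* (b :* d)) refl c a y p ⟩
  c *ⁿ y *ⁿ (a *ⁿ p)     ≤⟨ ℕ.*-monoˡ-≤ (a *ⁿ p) cy≤uv ⟩
  u *ⁿ v *ⁿ (a *ⁿ p)     ≡⟨ solve 4 (λ a b c d → a :* b :* (c :* d) := a :* (b :* d) :* c) refl u v a p ⟩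
  u *ⁿ (v *ⁿ p) *ⁿ a     ≤⟨ ℕ.*-monoˡ-≤ a uvp≤ ⟩
  B *ⁿ (z *ⁿ y) *ⁿ a     ≡⟨ solve 4 (λ a b c d → a :* (b :* c) :* d := a :* d :* (b :* c)) refl B z y a ⟩
  B *ⁿ a *ⁿ (z *ⁿ y)     ∎)
  where
  open ℕ.≤-Reasoning
  open +-*-Solver

cut-rare : ∀ r t → r ≤ 50 → let v = 2 *ⁿ (r + t *ⁿ 51) in
           length (cutTriples v) *ⁿ 2 ^ t ≤ constant *ⁿ length (matchingTriples v)
cut-rare r t r≤50 = chain-bounds (length (cutTriples v)) y z (2 ^ t)
  (length (matchingTriples v)) (length (balancedColourings v)) (41 ^ v) (20 ^ t) constant
  {{nonZero}} (union-bound v t t≤ c≤t)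
  (length-balancedColourings v t c≤t)
  (subst (λ p → 41 ^ v *ⁿ p ≤ constant *ⁿ (z *ⁿ y)) (^-distribʳ-* t 20 2) (proj₂ numeric-bound r t r≤50))
  where
  open ℕ.≤-Reasoning
  v = 2 *ⁿ (r + t *ⁿ 51)
  z = cube (5 ^ (16 *ⁿ t))
  y = 20 ^ v
  v≡ : v ≡ 2 *ⁿ r + 102 *ⁿ t
  v≡ = solve 2 (λ r t → con 2 :* (r :+ t :* con 51) := con 2 :* r :+ con 102 :* t) refl r t
    where open +-*-Solver
  t≤ : 102 *ⁿ t ≤ v
  t≤ = subst (102 *ⁿ t ≤_) (sym v≡) (ℕ.m≤n+m (102 *ⁿ t) (2 *ⁿ r))
  -- As 2r ≤ 100 is below 102, `t` is exactly ⌊v/102⌋.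
  c≤t : ∀ c → 102 *ⁿ c ≤ v → c ≤ t
  c≤t c le = s≤s⁻¹ (ℕ.*-cancelˡ-< 102 c (suc t) (begin-strict
    102 *ⁿ c               ≤⟨ le ⟩
    v                      ≡⟨ v≡ ⟩
    2 *ⁿ r + 102 *ⁿ t      <⟨ ℕ.+-monoˡ-< (102 *ⁿ t) (s≤s (ℕ.≤-trans (ℕ.*-monoʳ-≤ 2 r≤50) (ℕ.n≤1+n 100))) ⟩
    102 + 102 *ⁿ t         ≡⟨ ℕ.*-suc 102 t ⟨
    102 *ⁿ suc t           ∎))
  nonZero : NonZero (z *ⁿ y)
  nonZero = ℕ.m*n≢0 z y {{ℕ.m*n≢0 w (w *ⁿ w) {{w≢0}} {{ℕ.m*n≢0 w w {{w≢0}} {{w≢0}}}}}} {{ℕ.m^n≢0 20 v}}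
    where
    w = 5 ^ (16 *ⁿ t)
    w≢0 = ℕ.m^n≢0 5 (16 *ⁿ t)

-- From counts to probabilities

α : ℚ
α = ℤ.+ 1 / 102

n<102k⇒αn<k : ∀ n k → n <ⁿ 102 *ⁿ k → α * fromℕ n < fromℕ k
n<102k⇒αn<k n k lt = ℚ.toℚᵘ-cancel-< (ℚᵘ.<-respˡ-≃ (ℚᵘ.≃-sym lhs) (ℚᵘ.<-respʳ-≃ (ℚᵘ.≃-sym (toℚᵘ-fromℕ k)) (*<* (subst₂ ℤ._<_
    (sym (trans (cong (ℤ._* (ℤ.+ 1)) (ℤ.*-identityˡ (ℤ.+ n))) (ℤ.*-identityʳ (ℤ.+ n))))
    (trans (cong ℤ.+_ (ℕ.*-comm 102 k)) (ℤ.pos-* k 102))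
    (ℤ.+<+ lt)))))
  where
  toℚᵘ-fromℕ : ∀ m → toℚᵘ (fromℕ m) ℚᵘ.≃ mkℚᵘ (ℤ.+ m) 0
  toℚᵘ-fromℕ m = ℚ.toℚᵘ-fromℚᵘ (mkℚᵘ (ℤ.+ m) 0)
  lhs : toℚᵘ (α * fromℕ n) ℚᵘ.≃ mkℚᵘ (ℤ.+ 1) 101 ℚᵘ.* mkℚᵘ (ℤ.+ n) 0
  lhs = ℚᵘ.≃-trans (ℚ.toℚᵘ-homo-* α (fromℕ n)) (ℚᵘ.*-congˡ {mkℚᵘ (ℤ.+ 1) 101} (toℚᵘ-fromℕ n))

-- The distance to 1 is `b / suc l`, and a positive rational is at least 1 over its denominator, its
-- numerator being at least 1.
fraction-near-1 : ∀ g b l ε → 0ℚ < ε → g + b ≡ suc l → b *ⁿ ↧ₙ ε <ⁿ suc l →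
                  ∣ ℤ.+ g / suc l - 1ℚ ∣ℚ < ε
fraction-near-1 g b l (mkℚ (ℤ.+ zero) d _) (*<* (ℤ.+<+ ()))
fraction-near-1 g b l (mkℚ (ℤ.-[1+ _ ]) d _) (*<* ())
fraction-near-1 g b l ε@(mkℚ (ℤ.+[1+ p ]) d _) _ g+b lt = ℚ.toℚᵘ-cancel-<
  (ℚᵘ.<-respˡ-≃ (ℚᵘ.≃-sym lhs) (*<* (subst₂ ℤ._<_ left-side (ℤ.pos-* (suc p) (suc (l *ⁿ 1)))
    (ℤ.+<+ (ℕ.≤-trans lt (ℕ.≤-trans (ℕ.≤-reflexive (cong suc (sym (ℕ.*-identityʳ l))))
      (ℕ.m≤m+n (suc (l *ⁿ 1)) (p *ⁿ suc (l *ⁿ 1)))))))))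
  where
  i = ℤ.+ g ℤ.* ℤ.+ 1 ℤ.+ ℤ.-[1+ 0 ] ℤ.* ℤ.+ suc l
  i≡ : i ≡ g ℤ.⊖ (g + b)
  i≡ = trans (cong₂ ℤ._+_ (ℤ.*-identityʳ (ℤ.+ g)) (ℤ.-1*i≡-i (ℤ.+ suc l)))
    (trans (ℤ.m-n≡m⊖n g (suc l)) (cong (g ℤ.⊖_) (sym g+b)))
  ∣i∣≡b : ℤ.∣ i ∣ ≡ b
  ∣i∣≡b = trans (cong ℤ.∣_∣ i≡) (trans (ℤ.∣⊖∣-≤ (ℕ.m≤m+n g b)) (ℕ.m+n∸m≡n g b))
  left-side : ℤ.+ (b *ⁿ suc d) ≡ ℤ.+ ℤ.∣ i ∣ ℤ.* ℤ.+ suc d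
  left-side = trans (ℤ.pos-* b (suc d)) (cong (λ x → ℤ.+ x ℤ.* ℤ.+ suc d) (sym ∣i∣≡b))
  x = ℤ.+ g / suc l
  lhs : toℚᵘ ∣ x - 1ℚ ∣ℚ ℚᵘ.≃ ℚᵘ.∣ mkℚᵘ (ℤ.+ g) l ℚᵘ.+ mkℚᵘ ℤ.-[1+ 0 ] 0 ∣
  lhs = ℚᵘ.≃-trans (ℚ.toℚᵘ-homo-∣-∣ (x - 1ℚ)) (ℚᵘ.∣-∣-cong (ℚᵘ.≃-trans (ℚ.toℚᵘ-homo-+ x _)
    (ℚᵘ.+-congˡ (mkℚᵘ ℤ.-[1+ 0 ] 0) (ℚ.toℚᵘ-fromℚᵘ (mkℚᵘ (ℤ.+ g) l)))))

Pr-near-1 : ∀ {a p} {A : Set a} {P : Pred A p} (xs : List A) (P? : Decidable P) ε → 0ℚ < ε →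
            length (filter (¬? ∘ P?) xs) *ⁿ ↧ₙ ε <ⁿ length xs → ∣ Pr xs P? - 1ℚ ∣ℚ < ε
Pr-near-1 xs P? ε 0<ε lt with length xs | length-filter-¬ P? xs
... | suc l | eq = fraction-near-1 (length (filter P? xs)) _ l ε 0<ε eq lt

n<2^n : ∀ n → n <ⁿ 2 ^ n
n<2^n zero    = s≤s z≤n
n<2^n (suc n) = ℕ.+-mono-≤ (ℕ.≤-trans (s≤s z≤n) (n<2^n n)) (ℕ.≤-trans (n<2^n n) (ℕ.m≤m+n (2 ^ n) 0))

-- The bad proportion is at most B / 2^t, where `t` is the quotient of `m` by 51 and tends to
-- infinity; only the remainder `r` is bounded by 50.
Pr⟶1 : ∀ {a p} {A : ℕ → Set a} {P : ∀ m → Pred (A m) p} (xs : ∀ m → List (A m))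
       (P? : ∀ m → Decidable (P m)) (bad : ℕ → ℕ) B → (∀ m → 0 <ⁿ length (xs m)) →
       (∀ m → 2 ≤ m → length (filter (¬? ∘ P? m) (xs m)) ≤ bad m) →
       (∀ r t → r ≤ 50 → bad (r + t *ⁿ 51) *ⁿ 2 ^ t ≤ B *ⁿ length (xs (r + t *ⁿ 51))) →
       (λ m → Pr (xs m) (P? m)) ⟶ 1ℚ
-- From `m` at least 51Bd on, `t` is at least Bd, so 2^t exceeds Bd. The 2 ensures the hypothesis of
-- `count`, which later gives n = 2m at least 3 vertices.
Pr⟶1 xs P? bad B nonempty count rare ε 0<ε = 2 + 51 *ⁿ (B *ⁿ d) , close
  where
  d = ↧ₙ ε
  close : ∀ m → 2 + 51 *ⁿ (B *ⁿ d) ≤ m → ∣ Pr (xs m) (P? m) - 1ℚ ∣ℚ < ε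
  close m N≤m with m divMod 51
  ... | result t r refl = Pr-near-1 (xs m) (P? m) ε 0<ε
    (ℕ.≤-<-trans (ℕ.*-monoˡ-≤ d (count m (ℕ.≤-trans (ℕ.m≤m+n 2 _) N≤m))) (ℕ.≰⇒> few))
    where
    open ℕ.≤-Reasoning
    Bd≤t : B *ⁿ d ≤ t
    Bd≤t = s≤s⁻¹ (ℕ.*-cancelˡ-< 51 (B *ⁿ d) (suc t) (begin-strict
      51 *ⁿ (B *ⁿ d)     ≤⟨ ℕ.m≤n+m _ 2 ⟩
      2 + 51 *ⁿ (B *ⁿ d) ≤⟨ N≤m ⟩
      toℕ r + t *ⁿ 51    <⟨ ℕ.+-monoˡ-< (t *ⁿ 51) (Fin.toℕ<n r) ⟩
      51 + t *ⁿ 51       ≡⟨ ℕ.*-comm (suc t) 51 ⟩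
      51 *ⁿ suc t        ∎))
    few : ¬ length (xs m) ≤ bad m *ⁿ d
    few le = ℕ.<-irrefl refl (begin-strict
      B *ⁿ length (xs m)  ≤⟨ ℕ.*-monoʳ-≤ B le ⟩
      B *ⁿ (bad m *ⁿ d)   ≡⟨ solve 3 (λ a b c → a :* (b :* c) := b :* (a :* c)) refl B (bad m) d ⟩
      bad m *ⁿ (B *ⁿ d)   <⟨ ℕ.*-monoʳ-< (bad m) {{bad≢0}} (ℕ.≤-trans (s≤s Bd≤t) (n<2^n t)) ⟩
      bad m *ⁿ 2 ^ t      ≤⟨ rare (toℕ r) t (s≤s⁻¹ (Fin.toℕ<n r)) ⟩
      B *ⁿ length (xs m)  ∎)
      where
      open +-*-Solver
      bad≢0 : NonZero (bad m)
      bad≢0 = ℕ.m*n≢0⇒m≢0 (bad m) {{>-nonZero (ℕ.≤-trans (nonempty m) le)}}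

canCatch⇒αn<k : 3 ≤ n → (G : Graph n) → (∀ χ → Balanced χ → ¬ Separates χ G) →
                ∀ k → CanCatch k G → α * fromℕ n < fromℕ k
canCatch⇒αn<k {n} n≥3 G uncut k catch with n ℕ.<? 102 *ⁿ k
... | yes lt = n<102k⇒αn<k n k lt
... | no ≮   = contradiction catch (Game.¬canCatch n≥3 G uncut (ℕ.≮⇒≥ ≮))

-- `ent` is itself a number of cops that can catch the robber, so the bound for every such number
-- applies to it.
uncut⇒αn<ent : 3 ≤ n → (Ms : Graph n × Graph n × Graph n) → ¬ Cut Ms →
               α * fromℕ n < fromℕ (ent (unionOf Ms))
uncut⇒αn<ent {n} n≥3 Ms ¬cut = canCatch⇒αn<k n≥3 (unionOf Ms) uncut _ (ent-canCatch (unionOf Ms))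
  where
  uncut : ∀ χ → Balanced χ → ¬ Separates χ (unionOf Ms)
  uncut χ bal sep = ¬cut (lose (∈-filter⁺ balanced? (∈-vectors ∈-colours χ) bal) sep)

matchingCount-even>0 : ∀ m → 0 <ⁿ matchingCount (2 *ⁿ m)
matchingCount-even>0 zero    = s≤s z≤n
matchingCount-even>0 (suc m) rewrite ℕ.+-suc m (m + 0) =
  ℕ.≤-trans (matchingCount-even>0 m) (ℕ.m≤m+n _ _)

Evasive : Pred (Graph n × Graph n × Graph n) _
Evasive {n} Ms = α * fromℕ n < fromℕ (ent (unionOf Ms))

evasive? : Decidable (Evasive {n})
evasive? {n} Ms = α * fromℕ n <? fromℕ (ent (unionOf Ms))

catchable⇒cut : 3 ≤ n → ∀ {Ms : Graph n × Graph n × Graph n} → ¬ Evasive Ms → Cut Ms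
catchable⇒cut n≥3 {Ms} ¬evasive = decidable-stable (cut? Ms) (¬evasive ∘ uncut⇒αn<ent n≥3 Ms)

-- Evenness enters here: an empty sample space would have `Pr` equal to 0 by convention.
matchingTriples-nonempty : ∀ m → 0 <ⁿ length (matchingTriples (2 *ⁿ m))
matchingTriples-nonempty m = subst (0 <ⁿ_) (sym (length-matchingTriples (2 *ⁿ m))) (cube-mono {1}
  (ℕ.≤-trans (matchingCount-even>0 m) (matchingCount≤perfectMatchings (2 *ⁿ m))))

length-filter-catchable : ∀ n → 3 ≤ n → length (filter (¬? ∘ evasive?) (matchingTriples n)) ≤ length (cutTriples n)
length-filter-catchable n n≥3 = length-filter-mono {P = λ Ms → ¬ Evasive Ms} {Q = Cut}
  (¬? ∘ evasive?) cut? (matchingTriples n) (λ {Ms} _ → catchable⇒cut n≥3 {Ms})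

theorem2 : Σ[ α ∈ ℚ ] 0ℚ < α ×
    (λ m → Pr (matchingTriples (2 *ⁿ m))
    (λ Ms → α * fromℕ (2 *ⁿ m) <? fromℕ (ent (unionOf Ms)))) ⟶ 1ℚ
theorem2 = α , *<* (ℤ.+<+ (s≤s z≤n)) ,
  Pr⟶1 (λ m → matchingTriples (2 *ⁿ m)) (λ m → evasive? {2 *ⁿ m}) (λ m → length (cutTriples (2 *ⁿ m)))
    constant matchingTriples-nonempty
    (λ m m≥2 → length-filter-catchable (2 *ⁿ m) (ℕ.≤-trans (ℕ.n≤1+n 3) (ℕ.*-monoʳ-≤ 2 m≥2)))
    cut-rare
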